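{- Let $\mathcal F$ be a set of $2$-edge-coloured graphs on three vertices. If $\mathcal F\subseteq\{3K_1,{}^r\overline{P_3},{}^b\overline{P_3},{}^rP_3,{}^{rb}P_3,{}^rK_3,{}^{rrb}K_3\}$ or $\mathcal F\subseteq\{3K_1,{}^r\overline{P_3},{}^b\overline{P_3},{}^bP_3,{}^{rb}P_3,{}^bK_3,{}^{rbb}K_3\}$, then the $\mathcal F$-free colouring problem can be solved in polynomial time.
   Context: Graphs are finite and simple. A $2$-edge-colouring of $G$ assigns to every edge the colour red or blue (not necessarily properly). For a set $\mathcal F$ of $2$-edge-coloured graphs, a $2$-edge-colouring of $G$ is $\mathcal F$-free if no induced $2$-edge-coloured subgraph is isomorphic (preserving colours) to a member of $\mathcal F$. The $\mathcal F$-free colouring problem is to decide whether an input graph $G$ admits an $\mathcal F$-free $2$-edge-colouring. Patterns on three vertices: $3K_1$ is the edgeless graph; ${}^r\overline{P_3}$ (resp. ${}^b\overline{P_3}$) has exactly one edge, coloured red (resp. blue); ${}^rP_3$, ${}^bP_3$, ${}^{rb}P_3$ are the path on three vertices with both edges red, both edges blue, or one edge of each colour; ${}^rK_3$, ${}^bK_3$, ${}^{rrb}K_3$, ${}^{rbb}K_3$ are the triangle with all edges red, all edges blue, two red and one blue, or one red and two blue edges, respectively. -}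

module Defs where

open import Data.Bool.Base using (Bool; true; false; T)
open import Data.Fin.Base using (Fin)
open import Data.Fin.Patterns using (0F; 1F; 2F)
open import Data.Fin.Permutation using (Permutation; _⟨$⟩ʳ_)
open import Data.List.Base using (List; []; _∷_; _++_; concatMap; allFin; length; map; replicate)
open import Data.List.Relation.Unary.All using (All)
open import Data.List.Relation.Unary.Any using (Any)
open import Data.Maybe.Base using (Maybe; just; nothing; is-just)
open import Data.Maybe using (to-witness-T)
open import Data.Nat.Base using (ℕ; zero; suc; _+_; _*_; _^_)
open import Data.Product.Base using (Σ; _×_; _,_; ∃; ∃-syntax)
open import Data.Vec.Base as Vec using (Vec)
open import Function.Base using (_on_)
open import Function.Bundles using (_↣_; Injection)
open import Relation.Binary.PropositionalEquality using (_≡_; refl; cong)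
open import Relation.Nullary.Negation using (¬_)
open import Relation.Nullary.Reflects using (Reflects)

------------------------------------------------------------------------
-- Graphs and 2-edge-colourings

record Graph (n : ℕ) : Set where
  field
    adj     : Fin n → Fin n → Bool
    symm    : ∀ u v → adj u v ≡ adj v u
    irrefl  : ∀ u → adj u u ≡ false

  Edge : Fin n → Fin n → Set
  Edge u v = T (adj u v)

data Colour : Set where
  red blue : Colour

-- The colour is given on ordered pairs; `symm` makes it a function of the
-- undirected edge.
record EdgeColouring {n : ℕ} (G : Graph n) : Set where
  open Graph G using (Edge)
  field
    colour : ∀ u v → Edge u v → Colour
    symm   : ∀ u v (e : Edge u v) (e′ : Edge v u) → colour u v e ≡ colour v u e′

record ColouredGraph (n : ℕ) : Set where
  constructor _,_
  field
    graph     : Graph n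
    colouring : EdgeColouring graph

  open Graph graph public using (adj; Edge)
  open EdgeColouring colouring public using (colour)

record _≅_ {m n : ℕ} (G : ColouredGraph m) (H : ColouredGraph n) : Set where
  private
    module G = ColouredGraph G
    module H = ColouredGraph H
  field
    bijection : Permutation m n

  σ : Fin m → Fin n
  σ = bijection ⟨$⟩ʳ_

  field
    adj-preserved    : ∀ u v → G.adj u v ≡ H.adj (σ u) (σ v)
    colour-preserved : ∀ u v (e : G.Edge u v) (e′ : H.Edge (σ u) (σ v)) →
                       G.colour u v e ≡ H.colour (σ u) (σ v) e′

-- The subgraph induced by the set of vertices in the image of ι, with these
-- vertices renamed along ι.
induced : ∀ {m n} → ColouredGraph n → Fin m ↣ Fin n → ColouredGraph m
induced (G , c) ι = record
  { adj    = Graph.adj G on to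
  ; symm   = λ u v → Graph.symm G (to u) (to v)
  ; irrefl = λ u → Graph.irrefl G (to u)
  } , record
  { colour = λ u v → EdgeColouring.colour c (to u) (to v)
  ; symm   = λ u v → EdgeColouring.symm c (to u) (to v)
  }
  where open Injection ι using (to)

_Contains_ : ∀ {m n} → ColouredGraph n → ColouredGraph m → Set
_Contains_ {m} {n} G H = ∃[ ι ] induced {m} {n} G ι ≅ H

_-Free_ : ∀ {m n} → List (ColouredGraph m) → ColouredGraph n → Set
F -Free G = All (λ H → ¬ (G Contains H)) F

AdmitsFreeColouring : ∀ {m} → List (ColouredGraph m) → ∃ Graph → Set
AdmitsFreeColouring F (n , G) = Σ (EdgeColouring G) λ c → F -Free (G , c)

-- Inclusion of sets of coloured graphs, where isomorphic graphs are identified.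
_⊆≅_ : ∀ {m} → List (ColouredGraph m) → List (ColouredGraph m) → Set
F ⊆≅ F′ = All (λ H → Any (H ≅_) F′) F

------------------------------------------------------------------------
-- Coloured graphs on three vertices

-- `nothing` stands for a non-edge.
module _ (e₀₁ e₁₂ e₀₂ : Maybe Colour) where

  private
    link : Fin 3 → Fin 3 → Maybe Colour
    link 0F 0F = nothing
    link 0F 1F = e₀₁
    link 0F 2F = e₀₂
    link 1F 0F = e₀₁
    link 1F 1F = nothing
    link 1F 2F = e₁₂
    link 2F 0F = e₀₂
    link 2F 1F = e₁₂
    link 2F 2F = nothing

    link-symm : ∀ u v → link u v ≡ link v u
    link-symm 0F 0F = refl
    link-symm 0F 1F = refl
    link-symm 0F 2F = refl
    link-symm 1F 0F = refl
    link-symm 1F 1F = refl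
    link-symm 1F 2F = refl
    link-symm 2F 0F = refl
    link-symm 2F 1F = refl
    link-symm 2F 2F = refl

    link-irrefl : ∀ u → link u u ≡ nothing
    link-irrefl 0F = refl
    link-irrefl 1F = refl
    link-irrefl 2F = refl

    witness-unique : ∀ {x y : Maybe Colour} → x ≡ y →
                     (p : T (is-just x)) (q : T (is-just y)) →
                     to-witness-T x p ≡ to-witness-T y q
    witness-unique {just _} refl _ _ = refl

  onThreeVertices : ColouredGraph 3
  onThreeVertices = record
    { adj    = λ u v → is-just (link u v)
    ; symm   = λ u v → cong is-just (link-symm u v)
    ; irrefl = λ u → cong is-just (link-irrefl u)
    } , record
    { colour = λ u v → to-witness-T (link u v)
    ; symm   = λ u v → witness-unique (link-symm u v)
    }

private
  r b ∙ : Maybe Colour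
  r = just red
  b = just blue
  ∙ = nothing

3K₁ ʳco-P₃ ᵇco-P₃ ʳP₃ ᵇP₃ ʳᵇP₃ ʳK₃ ᵇK₃ ʳʳᵇK₃ ʳᵇᵇK₃ : ColouredGraph 3
3K₁    = onThreeVertices ∙ ∙ ∙
ʳco-P₃ = onThreeVertices r ∙ ∙
ᵇco-P₃ = onThreeVertices b ∙ ∙
ʳP₃    = onThreeVertices r r ∙
ᵇP₃    = onThreeVertices b b ∙
ʳᵇP₃   = onThreeVertices r b ∙
ʳK₃    = onThreeVertices r r r
ᵇK₃    = onThreeVertices b b b
ʳʳᵇK₃  = onThreeVertices r r b
ʳᵇᵇK₃  = onThreeVertices r b b

------------------------------------------------------------------------
-- Deterministic multi-tape Turing machines

data Symbol (s : ℕ) : Set where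
  blank : Symbol s
  bit   : Bool → Symbol s
  extra : Fin s → Symbol s

data Move : Set where
  left stay right : Move

data Action (states s tapes : ℕ) : Set where
  halt     : (accept : Bool) → Action states s tapes
  continue : Fin states → Vec (Symbol s × Move) tapes → Action states s tapes

record TuringMachine : Set where
  field
    states workTapes extraSymbols : ℕ
    start : Fin states
    δ     : Fin states → Vec (Symbol extraSymbols) (suc workTapes) →
            Action states extraSymbols (suc workTapes)

-- A two-way infinite tape. Both lists start with the cell nearest to the head;
-- all cells beyond their ends are blank.
record Tape (s : ℕ) : Set where
  constructor tape
  field
    before  : List (Symbol s)
    current : Symbol s
    after   : List (Symbol s)

module _ {s : ℕ} where

  fromList : List (Symbol s) → Tape s
  fromList []       = tape [] blank []
  fromList (x ∷ xs) = tape [] x xs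

  move : Move → Tape s → Tape s
  move stay  t                    = t
  move left  (tape []       x rs) = tape [] blank (x ∷ rs)
  move left  (tape (l ∷ ls) x rs) = tape ls l (x ∷ rs)
  move right (tape ls x [])       = tape (x ∷ ls) blank []
  move right (tape ls x (r ∷ rs)) = tape (x ∷ ls) r rs

  writeMove : Symbol s × Move → Tape s → Tape s
  writeMove (x , d) t = move d (record t { current = x })

module _ (M : TuringMachine) where
  open TuringMachine M

  Configuration : Set
  Configuration = Fin states × Vec (Tape extraSymbols) (suc workTapes)

  initial : List Bool → Configuration
  initial w = start , fromList (map bit w) Vec.∷ Vec.replicate workTapes (fromList [])

  -- The answer of the machine if it halts within the given number of steps.
  runFor : ℕ → Configuration → Maybe Bool
  runFor zero    _        = nothing
  runFor (suc t) (q , ts) with δ q (Vec.map Tape.current ts)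
  ... | halt a         = just a
  ... | continue q′ ws = runFor t (q′ , Vec.zipWith writeMove ws ts)

-- The problem P, with instances given to the machine by `encode`, is decided by
-- some machine within c·ℓᵈ + c steps on every instance of encoded length ℓ.
SolvableInPolynomialTime : {A : Set} → (A → List Bool) → (A → Set) → Set
SolvableInPolynomialTime {A} encode P =
  ∃[ M ] ∃[ c ] ∃[ d ] ∀ (x : A) →
    ∃[ answer ]
      runFor M (c * length (encode x) ^ d + c) (initial M (encode x)) ≡ just answer
      × Reflects (P x) answer

-- The number of vertices in unary, a separator, and the adjacency matrix row by
-- row.
encodeGraph : ∃ Graph → List Bool
encodeGraph (n , G) =
  replicate n true ++ false ∷ concatMap (λ u → map (Graph.adj G u) (allFin n)) (allFin n)

{-# OPTIONS --safe #-}

-- Call the colour of the two monochromatic patterns ʳP₃, ʳK₃ (resp. ᵇP₃, ᵇK₃)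
-- hot and the other colour cold. The patterns that may be forbidden are exactly
-- those with at most one cold edge, so forbidding them on the vertices u, v, w
-- is a Horn clause in the variables "uv is hot". Start with all edges cold and
-- heat a cold edge as long as it is the cold edge of a forbidden triple: every
-- free colouring contains the hot edges obtained in this way, so the final
-- colouring is free unless there is no free colouring.
--
-- A machine with four tapes does this in rounds. The tapes hold the matrix
-- being updated (head at uv), a unary copy of n, and two copies of the matrix
-- from the beginning of the round (heads at uw and vw). A round costs O(n³)
-- steps and every round but the last heats an edge.
module Submission where

open import Defs
open import Data.Bool.Base using (Bool; true; false; not; _∧_; _∨_; if_then_else_; T)
open import Data.Bool.Properties using (∨-comm; ∨-assoc)
open import Data.Bool.ListAction using (any; or)
open import Data.Fin.Base using (Fin; zero; suc; toℕ)
open import Data.Fin.Patterns using (0F; 1F; 2F)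
open import Data.Fin.Permutation as Permutation using (_⟨$⟩ˡ_; inverseʳ)
import Data.Fin.Properties as Fin
open import Data.Fin.Properties using (2↔Bool; *↔×)
open import Data.List.Base using (List; []; _∷_)
import Data.List.Base as List
import Data.List.Properties as List
open import Data.List.Relation.Binary.Pointwise.Base using (Pointwise; []; _∷_)
open import Data.List.Relation.Unary.All using (All; []; _∷_)
open import Data.List.Relation.Unary.Any using (Any; here; there)
open import Data.Maybe.Base using (Maybe; just; nothing; is-just)
open import Data.Maybe using (to-witness-T)
open import Data.Maybe.Properties using (just-injective)
open import Data.Nat.Base using (ℕ; zero; suc; _+_; _*_; _^_; _∸_; _≤_; _<_; z≤n; s≤s; s≤s⁻¹; _≡ᵇ_)
open import Data.Nat.Properties
  using (+-assoc; +-identityʳ; +-suc; +-monoʳ-≤; +-mono-≤; +-mono-<-≤; +-mono-≤-<; *-mono-≤; *-monoʳ-≤; *-identityʳ;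
         ≤-refl; ≤-reflexive; ≤-trans; m≤m+n; m≤n+m; m+[n∸m]≡n; module ≤-Reasoning)
open import Data.Nat.Tactic.RingSolver using (solve-∀)
open import Data.Product.Base using (_×_; _,_; ∃; proj₁; proj₂)
open import Data.Product.Function.NonDependent.Propositional using (_×-↔_)
open import Data.Sum.Base using (_⊎_; inj₁; inj₂)
open import Data.Unit.Base using (tt)
open import Data.Vec.Base using (Vec; []; _∷_; _∷ʳ_; zipWith; reverse; concat; replicate; lookup; tabulate; sum)
import Data.Vec.Base as Vec
open import Data.Vec.Properties using (reverse-∷; lookup-map; lookup-zipWith; zipWith-comm; lookup∘tabulate)
open import Function.Base using (_∘_; id)
open import Function.Bundles using (_↔_; Inverse; Injection; mk↣)
open import Function.Construct.Composition using (_↔-∘_)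
open import Function.Construct.Identity using (↔-id)
open import Function.Construct.Symmetry using (↔-sym)
open import Function.Properties.Inverse using (↔⇒↣)
open import Relation.Binary.PropositionalEquality using (_≡_; _≢_; refl; sym; trans; cong; cong₂; subst; subst₂)
open import Relation.Nullary.Decidable.Core using (does; yes; no)
open import Relation.Nullary.Negation using (¬_; contradiction)
open import Relation.Nullary.Reflects using (Reflects; ofʸ; ofⁿ)

-- The delicate point is when a forbidden triple proves that there is no free colouring. A triple
-- found at a hot edge or a non-edge may still have a cold edge elsewhere, and then the round just
-- heats that edge. But every triple is inspected from all three of its pairs. So in a round that
-- heats nothing, no forbidden triple contains a cold edge. Every free colouring agrees with the
-- matrix on the cells that are not cold, hence contains the same triple.
--
-- Reading from copies makes a round a simultaneous update: `uv` and `vu` receive the same value, so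
-- the matrix is symmetric again when the round ends, and the new matrix is a plain function of the
-- old one.

-- The entries of the matrix: `bit false` is a non-edge and `bit true` a cold
-- edge, as in the encoding of the graph. The diagonal needs a cell of its own,
-- since a non-edge there would make u, v, u look like a path.
data Cell : Set where
  bit     : Bool → Cell
  dia hot : Cell

-- The tape alphabet, and tapes as zippers.

Γ : Set
Γ = Maybe Cell

pattern ∅ = nothing

-- The head reads the first symbol of the right list.
record Zipper : Set where
  constructor _▮_
  field
    before after : List Γ

infix 3 _▮_

head : List Γ → Γ
head []      = ∅
head (x ∷ _) = x

tail : List Γ → List Γ
tail []       = []
tail (_ ∷ xs) = xs

read : Zipper → Γ
read (_ ▮ r) = head r

data Op : Set where
  keep  : Move → Op
  write : Γ → Move → Op

pattern ● = keep stay
pattern ◀ = keep left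
pattern ▶ = keep right

shift : Move → Zipper → Zipper
shift left  (l ▮ r) = tail l ▮ head l ∷ head r ∷ tail r
shift stay  z       = z
shift right (l ▮ r) = head r ∷ l ▮ tail r

apply : Op → Zipper → Zipper
apply (keep m)    z       = shift m z
apply (write x m) (l ▮ r) = shift m (l ▮ x ∷ tail r)

symbol : Γ → Symbol 2
symbol ∅              = blank
symbol (just (bit x)) = bit x
symbol (just dia)     = extra zero
symbol (just hot)     = extra (suc zero)

unsymbol : Symbol 2 → Γ
unsymbol blank            = ∅
unsymbol (bit x)          = just (bit x)
unsymbol (extra zero)     = just dia
unsymbol (extra (suc _))  = just hot

unsymbol-symbol : ∀ x → unsymbol (symbol x) ≡ x
unsymbol-symbol ∅              = refl
unsymbol-symbol (just (bit _)) = refl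
unsymbol-symbol (just dia)     = refl
unsymbol-symbol (just hot)     = refl

toTape : Zipper → Tape 2
toTape (l ▮ r) = tape (List.map symbol l) (symbol (head r)) (List.map symbol (tail r))

output : Op → Symbol 2 → Symbol 2 × Move
output (keep m)    x = x , m
output (write y m) _ = symbol y , m

move-toTape : ∀ m z → move m (toTape z) ≡ toTape (shift m z)
move-toTape stay  z                 = refl
move-toTape left  ([] ▮ r)          = refl
move-toTape left  (x ∷ l ▮ r)       = refl
move-toTape right (l ▮ [])          = refl
move-toTape right (l ▮ x ∷ [])      = refl
move-toTape right (l ▮ x ∷ y ∷ r)   = refl

writeMove-toTape : ∀ o z → writeMove (output o (symbol (read z))) (toTape z) ≡ toTape (apply o z)
writeMove-toTape (keep m)    z       = move-toTape m z
writeMove-toTape (write x m) (l ▮ r) = move-toTape m (l ▮ x ∷ tail r)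

-- Four-tape machines, composition of runs, translation into Turing machines.

module FourTapeMachine (State : Set) where

  data Act : Set where
    halt : Bool → Act
    go   : State → (_ _ _ _ : Op) → Act

  module Run (δ : State → (_ _ _ _ : Γ) → Act) where

    record Config : Set where
      constructor ⟨_,_,_,_,_⟩
      field
        state       : State
        z₁ z₂ z₃ z₄ : Zipper

    perform : Act → (_ _ _ _ : Zipper) → Bool ⊎ Config
    perform (halt a)           _  _  _  _  = inj₁ a
    perform (go q o₁ o₂ o₃ o₄) z₁ z₂ z₃ z₄ =
      inj₂ ⟨ q , apply o₁ z₁ , apply o₂ z₂ , apply o₃ z₃ , apply o₄ z₄ ⟩

    step : Config → Bool ⊎ Config
    step ⟨ q , z₁ , z₂ , z₃ , z₄ ⟩ =
      perform (δ q (read z₁) (read z₂) (read z₃) (read z₄)) z₁ z₂ z₃ z₄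

    run    : ℕ → Config → Maybe Bool
    resume : ℕ → Bool ⊎ Config → Maybe Bool
    run zero    _ = nothing
    run (suc t) k = resume t (step k)
    resume _ (inj₁ a) = just a
    resume t (inj₂ k) = run t k

    infix 2 _⟶[_]_
    infixr 4 _⨾_ _then_

    -- The arbitrary number `t` of remaining steps makes the composition of runs a mere
    -- reassociation of sums.
    record _⟶[_]_ (k : Config) (j : ℕ) (k′ : Config) : Set where
      constructor steps
      field
        run-≡ : ∀ t → run (j + t) k ≡ run t k′

    open _⟶[_]_ public

    done : ∀ {k} → k ⟶[ 0 ] k
    done = steps λ _ → refl

    _then_ : ∀ {k k′ k″ j} → step k ≡ inj₂ k′ → k′ ⟶[ j ] k″ → k ⟶[ suc j ] k″
    _then_ {j = j} eq f = steps λ t → trans (cong (resume (j + t)) eq) (run-≡ f t)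

    _⨾_ : ∀ {k k′ k″ i j} → k ⟶[ i ] k′ → k′ ⟶[ j ] k″ → k ⟶[ i + j ] k″
    _⨾_ {k} {i = i} {j} f g = steps λ t →
      trans (cong (λ s → run s k) (+-assoc i j t)) (trans (run-≡ f (j + t)) (run-≡ g t))

    -- The surplus `t` allows an early halt to be counted against a larger bound.
    record HaltsWith (a : Bool) (j : ℕ) (k : Config) : Set where
      constructor halts
      field
        run-≡ : ∀ t → run (j + t) k ≡ just a

    haltsNow : ∀ {a j k} → step k ≡ inj₁ a → HaltsWith a (suc j) k
    haltsNow eq = halts λ _ → cong (resume _) eq

    haltsLater : ∀ {a i k} → HaltsWith a i k → ∀ j → HaltsWith a (i + j) k
    haltsLater {i = i} {k} (halts h) j = halts λ t → trans (cong (λ s → run s k) (+-assoc i j t)) (h (j + t))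

    haltsAfter : ∀ {a i j k k′} → k ⟶[ i ] k′ → HaltsWith a j k′ → HaltsWith a (i + j) k
    haltsAfter {i = i} {j} {k} f (halts h) = halts λ t →
      trans (cong (λ s → run s k) (+-assoc i j t)) (trans (run-≡ f (j + t)) (h t))

    module _ {states : ℕ} (code : Fin states ↔ State) (start : State) where
      encode : State → Fin states
      encode = Inverse.from code

      decode : Fin states → State
      decode = Inverse.to code

      decode-encode : ∀ q → decode (encode q) ≡ q
      decode-encode = Inverse.strictlyInverseˡ code

      toAction : Act → (_ _ _ _ : Symbol 2) → Action states 2 4
      toAction (halt a)           _  _  _  _  = halt a
      toAction (go q o₁ o₂ o₃ o₄) x₁ x₂ x₃ x₄ =
        continue (encode q) (output o₁ x₁ ∷ output o₂ x₂ ∷ output o₃ x₃ ∷ output o₄ x₄ ∷ [])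

      machine : TuringMachine
      machine = record
        { states       = states
        ; workTapes    = 3
        ; extraSymbols = 2
        ; start        = encode start
        ; δ            = λ { q (x₁ ∷ x₂ ∷ x₃ ∷ x₄ ∷ []) →
            toAction (δ (decode q) (unsymbol x₁) (unsymbol x₂) (unsymbol x₃) (unsymbol x₄)) x₁ x₂ x₃ x₄ }
        }

      toConfiguration : Config → Configuration machine
      toConfiguration ⟨ q , z₁ , z₂ , z₃ , z₄ ⟩ =
        encode q , toTape z₁ ∷ toTape z₂ ∷ toTape z₃ ∷ toTape z₄ ∷ []

      -- The round trips `decode-encode` and `unsymbol-symbol` let both machines consult `δ` at the
      -- same arguments, so the translation costs no extra steps.
      runFor-run : ∀ t k → runFor machine t (toConfiguration k) ≡ run t k
      runFor-run zero    _ = refl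
      runFor-run (suc t) ⟨ q , z₁ , z₂ , z₃ , z₄ ⟩
        rewrite decode-encode q
              | unsymbol-symbol (read z₁) | unsymbol-symbol (read z₂)
              | unsymbol-symbol (read z₃) | unsymbol-symbol (read z₄)
        with δ q (read z₁) (read z₂) (read z₃) (read z₄)
      ... | halt a = refl
      ... | go q′ o₁ o₂ o₃ o₄
        rewrite writeMove-toTape o₁ z₁ | writeMove-toTape o₂ z₂
              | writeMove-toTape o₃ z₃ | writeMove-toTape o₄ z₄ = runFor-run t _

-- Segments of tape to the right and to the left of the head.

infixr 5 _▹_ _◃_ _▸_ _◂_

_▹_ : ∀ {k} → Vec Cell k → List Γ → List Γ
[]       ▹ l = l
(x ∷ xs) ▹ l = just x ∷ xs ▹ l

_◃_ : ∀ {k} → Vec Cell k → List Γ → List Γ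
[]       ◃ l = l
(x ∷ xs) ◃ l = xs ◃ (just x ∷ l)

_▸_ : ∀ {k n} → Vec (Vec Cell n) k → List Γ → List Γ
[]       ▸ l = l
(r ∷ rs) ▸ l = r ▹ rs ▸ l

_◂_ : ∀ {k n} → Vec (Vec Cell n) k → List Γ → List Γ
[]       ◂ l = l
(r ∷ rs) ◂ l = rs ◂ (r ◃ l)

∷ʳ-▹ : ∀ {k} (xs : Vec Cell k) x l → (xs ∷ʳ x) ▹ l ≡ xs ▹ (just x ∷ l)
∷ʳ-▹ []       x l = refl
∷ʳ-▹ (y ∷ xs) x l = cong (just y ∷_) (∷ʳ-▹ xs x l)

∷ʳ-◃ : ∀ {k} (xs : Vec Cell k) x l → (xs ∷ʳ x) ◃ l ≡ just x ∷ xs ◃ l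
∷ʳ-◃ []       x l = refl
∷ʳ-◃ (y ∷ xs) x l = ∷ʳ-◃ xs x (just y ∷ l)

reverse-▹ : ∀ {k} (xs : Vec Cell k) l → reverse xs ▹ l ≡ xs ◃ l
reverse-▹ []       l = refl
reverse-▹ (x ∷ xs) l rewrite reverse-∷ x xs | ∷ʳ-▹ (reverse xs) x l = reverse-▹ xs (just x ∷ l)

reverse-◃ : ∀ {k} (xs : Vec Cell k) l → reverse xs ◃ l ≡ xs ▹ l
reverse-◃ []       l = refl
reverse-◃ (x ∷ xs) l rewrite reverse-∷ x xs | ∷ʳ-◃ (reverse xs) x l = cong (just x ∷_) (reverse-◃ xs l)

++-▹ : ∀ {i j} (xs : Vec Cell i) (ys : Vec Cell j) l → (xs Vec.++ ys) ▹ l ≡ xs ▹ ys ▹ l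
++-▹ []       ys l = refl
++-▹ (x ∷ xs) ys l = cong (just x ∷_) (++-▹ xs ys l)

++-◃ : ∀ {i j} (xs : Vec Cell i) (ys : Vec Cell j) l → (xs Vec.++ ys) ◃ l ≡ ys ◃ xs ◃ l
++-◃ []       ys l = refl
++-◃ (x ∷ xs) ys l = ++-◃ xs ys (just x ∷ l)

concat-▹ : ∀ {k n} (rs : Vec (Vec Cell n) k) l → concat rs ▹ l ≡ rs ▸ l
concat-▹ []       l = refl
concat-▹ (r ∷ rs) l = trans (++-▹ r (concat rs) l) (cong (r ▹_) (concat-▹ rs l))

concat-◃ : ∀ {k n} (rs : Vec (Vec Cell n) k) l → concat rs ◃ l ≡ rs ◂ l
concat-◃ []       l = refl
concat-◃ (r ∷ rs) l = trans (++-◃ r (concat rs) l) (concat-◃ rs (r ◃ l))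

-- Agrees with `shift left` by computation only if the right list visibly has a first element, since
-- `shift left` rebuilds it from its head and tail.
retreat : Zipper → Zipper
retreat (l ▮ r) = tail l ▮ head l ∷ r

isCold : Cell → Bool
isCold (bit true) = true
isCold _          = false

raise : Bool → Cell → Cell
raise true (bit true) = hot
raise _    x          = x

-- The accumulator comes first because it models a flag that the machine carries in its state.
orFrom : ∀ {k} → Bool → Vec Bool k → Bool
orFrom h []       = h
orFrom h (x ∷ xs) = orFrom (h ∨ x) xs

-- While row i of the matrix is read, the clock starts with i cells `false`, so
-- that its first `true` marks the diagonal.
tick : ∀ {k} → Vec Bool k → Vec Bool k
tick []           = []
tick (false ∷ xs) = false ∷ tick xs
tick (true  ∷ xs) = false ∷ xs

markRow : ∀ {k} → Vec Bool k → Vec Cell k → Vec Cell k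
markRow []           []       = []
markRow (false ∷ bs) (x ∷ xs) = x ∷ markRow bs xs
markRow (true  ∷ bs) (x ∷ xs) = dia ∷ xs

markRows : ∀ {k n} → Vec Bool n → Vec (Vec Cell n) k → Vec (Vec Cell n) k
markRows bs []       = []
markRows bs (r ∷ rs) = markRow bs r ∷ markRows (tick bs) rs

-- This and the following step counts have the shape in which the runs are composed, so the
-- simulations need no arithmetic. They are estimated in `TimeBound`.
markingCost : ℕ → ℕ → ℕ
markingCost n zero    = 1
markingCost n (suc k) = n + 1 + (n + suc (markingCost n k))

-- Here `k + 1` entries of the row are left; after the last one there is no walk back.
rowCost : ℕ → ℕ → ℕ
rowCost n zero    = n + 1
rowCost n (suc k) = n + suc (n + 1 + rowCost n k)

passCost : ℕ → ℕ → ℕ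
passCost m zero    = rowCost (suc m) m
passCost m (suc k) = rowCost (suc m) m + suc (suc m * suc m + 1 + (suc m + suc (passCost m k)))

roundCost : ℕ → ℕ
roundCost m = passCost m m + suc (suc m + suc (suc m * suc m + 1))

setupCost : ℕ → ℕ
setupCost m = 1 + (suc m + 1) + (suc m + suc (markingCost (suc m) (suc m) + (suc m * suc m + 1)))

-- The machine and its runs.

module Decider (bad : Cell → Cell → Cell → Bool) where

  pattern start      = zero
  pattern count      = suc start
  pattern rewindMark = suc count
  pattern markA      = suc rewindMark
  pattern markB      = suc markA
  pattern copy       = suc markB
  pattern scan       = suc copy
  pattern back       = suc scan
  pattern next       = suc back
  pattern rewindCol  = suc next
  pattern rewindScan = suc rewindCol
  pattern rewindCopy = suc rewindScan

  State : Set
  State = Fin 12 × Bool × Bool × Bool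

  open FourTapeMachine State public

  badΓ : Γ → Γ → Γ → Bool
  badΓ (just x) (just y) (just z) = bad x y z
  badΓ _        _        _        = false

  -- The flags of a state tell whether a w with uvw forbidden was found for the
  -- current uv, whether an edge was heated in this round, and whether a
  -- forbidden uvw with uv not cold was found in this round. If no edge was
  -- heated, the last flag decides.
  δ : State → (_ _ _ _ : Γ) → Act
  -- The heads of the work tapes leave one blank on their left as an end marker.
  δ (start , f) (just (bit true)) _ _ _ = go (count , f) ● ▶ ▶ ▶
  δ (start , f) _                 _ _ _ = halt true
  δ (count , f) (just (bit true)) _ _ _ = go (count , f) (write ∅ right) (write (just (bit true)) right) ● ●
  -- Erasing the separator puts an end marker to the left of the matrix.
  δ (count , f) _                 _ _ _ = go (rewindMark , f) (write ∅ right) ◀ ● ●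
  δ (rewindMark , f) _ (just _) _ _ = go (rewindMark , f) ● ◀ ● ●
  δ (rewindMark , f) _ ∅        _ _ = go (markA , f) ● ▶ ● ●
  δ (markA , f) x ∅                 _ _ = go (rewindMark , f) ● ◀ ● ●
  δ (markA , f) ∅ (just _)          _ _ = go (copy , f) ◀ ● ◀ ◀
  δ (markA , f) (just x) (just (bit true)) _ _ =
    go (markB , f) (write (just dia) right) (write (just (bit false)) right) (write (just dia) right) (write (just dia) right)
  δ (markA , f) (just x) (just _) _ _ = go (markA , f) ▶ ▶ (write (just x) right) (write (just x) right)
  δ (markB , f) x ∅        _ _ = go (rewindMark , f) ● ◀ ● ●
  δ (markB , f) x (just _) _ _ = go (markB , f) ▶ ▶ (write x right) (write x right)
  -- A pass leaves the heads behind the last cell, so copying leftwards rewinds them in the same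
  -- sweep.
  δ (copy , f) (just x) _ _ _ = go (copy , f) ◀ ● (write (just x) left) (write (just x) left)
  δ (copy , f) ∅        _ _ _ = go (scan , false , false , false) ▶ ● ▶ ▶
  δ (scan , h , c , b) x (just _) y z = go (scan , h ∨ badΓ x y z , c , b) ● ▶ ▶ ▶
  δ (scan , h , c , b) ∅ ∅ _ _ = halt false
  -- A blank on the fourth tape means that `v` was the last vertex. The third head has then just
  -- left row `u` and is in place for the next row.
  δ (scan , h , c , b) (just x) ∅ _ ∅ =
    go (next , false , c ∨ (h ∧ isCold x) , b ∨ (h ∧ not (isCold x))) (write (just (raise h x)) right) ● ● ●
  δ (scan , h , c , b) (just x) ∅ _ (just _) =
    go (back , false , c ∨ (h ∧ isCold x) , b ∨ (h ∧ not (isCold x))) (write (just (raise h x)) right) ◀ ◀ ●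
  -- The clock is as long as row `u`, so its end marker also stops the third head at the start of
  -- the row.
  δ (back , f) _ (just _) _ _ = go (back , f) ● ◀ ◀ ●
  δ (back , f) _ ∅        _ _ = go (scan , f) ● ▶ ▶ ●
  δ (next , f) (just _) _ _ _ = go (rewindCol , f) ● ● ● ◀
  δ (next , f@(_ , c , b)) ∅ _ _ _ = if c then go (rewindCopy , f) ◀ ◀ ◀ ◀ else halt (not b)
  δ (rewindCol , f) _ _ _ (just _) = go (rewindCol , f) ● ● ● ◀
  δ (rewindCol , f) _ _ _ ∅        = go (rewindScan , f) ● ◀ ● ▶
  δ (rewindScan , f) _ (just _) _ _ = go (rewindScan , f) ● ◀ ● ●
  δ (rewindScan , f) _ ∅        _ _ = go (scan , f) ● ▶ ● ●
  δ (rewindCopy , f) _ (just _) _ _ = go (rewindCopy , f) ● ◀ ● ●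
  δ (rewindCopy , f) _ ∅        _ _ = go (copy , f) ● ▶ ● ●

  open Run δ public

  code : Fin (12 * (2 * (2 * 2))) ↔ State
  code = (↔-id _ ×-↔ ((2↔Bool ×-↔ ((2↔Bool ×-↔ 2↔Bool) ↔-∘ *↔× {2} {2})) ↔-∘ *↔× {2} {4})) ↔-∘ *↔× {12} {8}

  clock : ∀ {k} → Vec Cell k → Zipper
  clock cs = ∅ ∷ [] ▮ cs ▹ ∅ ∷ []

  expired : ∀ {k} → Vec Cell k → Zipper
  expired cs = cs ◃ ∅ ∷ [] ▮ ∅ ∷ []

  -- Shared by the three states that rewind the clock, hence the hypotheses on `δ`. The head meets
  -- the last cell first, so the walk runs over `reverse cs`.
  rewindClock : ∀ {q q′ k j κ z₁ z₃ z₄} →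
    (∀ {x y z w} → δ q x (just y) z w ≡ go q ● ◀ ● ●) → (∀ {x z w} → δ q x ∅ z w ≡ go q′ ● ▶ ● ●) →
    (cs : Vec Cell k) → ⟨ q′ , z₁ , clock cs , z₃ , z₄ ⟩ ⟶[ j ] κ →
    ⟨ q , z₁ , retreat (expired cs) , z₃ , z₄ ⟩ ⟶[ k + suc j ] κ
  rewindClock {q} {k = k} {z₁ = z₁} {z₃} {z₄} rewinds stops cs f =
    subst₂ (λ l r → at (l ▮ ∅ ∷ []) ⟶[ k ] at (∅ ∷ [] ▮ r))
      (reverse-▹ cs _) (reverse-◃ cs _) (walk (reverse cs) _)
    ⨾ cong (λ a → perform a z₁ _ z₃ z₄) stops
    then f
    where
    at : Zipper → Config
    at z = ⟨ q , z₁ , retreat z , z₃ , z₄ ⟩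

    walk : ∀ {k} (xs : Vec Cell k) r → at (xs ▹ ∅ ∷ [] ▮ r) ⟶[ k ] at (∅ ∷ [] ▮ xs ◃ r)
    walk []       r = done
    walk (x ∷ xs) r = cong (λ a → perform a z₁ _ z₃ z₄) rewinds then walk xs (just x ∷ r)

  counting : ∀ {f l r c z₃ z₄} n →
             ⟨ (count , f) , l ▮ Vec.map bit (replicate n true) ▹ r , c ▮ [] , z₃ , z₄ ⟩ ⟶[ n ]
             ⟨ (count , f) , List.replicate n ∅ List.ʳ++ l ▮ r , Vec.map bit (replicate n true) ◃ c ▮ [] , z₃ , z₄ ⟩
  counting zero    = done
  counting (suc n) = refl then counting n

  starting : ∀ {f} n r →
    ⟨ (start , f) , [] ▮ Vec.map bit (replicate (suc n) true) ▹ just (bit false) ∷ r , [] ▮ [] , [] ▮ [] , [] ▮ [] ⟩ ⟶[ 1 + (suc n + 1) ]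
    ⟨ (rewindMark , f) , ∅ ∷ (List.replicate (suc n) ∅ List.ʳ++ []) ▮ r , retreat (expired (Vec.map bit (replicate (suc n) true))) ,
      ∅ ∷ [] ▮ [] , ∅ ∷ [] ▮ [] ⟩
  starting n r = refl then counting (suc n) ⨾ refl then done

  markingTail : ∀ {f k pl pr cl yl zl} (bs : Vec Cell k) (xs : Vec Cell k) →
    ⟨ (markB , f) , pl ▮ xs ▹ pr , cl ▮ bs ▹ ∅ ∷ [] , yl ▮ [] , zl ▮ [] ⟩ ⟶[ k + 1 ]
    ⟨ (rewindMark , f) , xs ◃ pl ▮ pr , retreat (bs ◃ cl ▮ ∅ ∷ []) , xs ◃ yl ▮ [] , xs ◃ zl ▮ [] ⟩
  markingTail []       []       = refl then done
  markingTail (b ∷ bs) (x ∷ xs) = refl then markingTail bs xs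

  marking : ∀ {f k pl pr cl yl zl} (bs : Vec Bool k) (xs : Vec Cell k) →
    ⟨ (markA , f) , pl ▮ xs ▹ pr , cl ▮ Vec.map bit bs ▹ ∅ ∷ [] , yl ▮ [] , zl ▮ [] ⟩ ⟶[ k + 1 ]
    ⟨ (rewindMark , f) , markRow bs xs ◃ pl ▮ pr , retreat (Vec.map bit (tick bs) ◃ cl ▮ ∅ ∷ []) ,
      markRow bs xs ◃ yl ▮ [] , markRow bs xs ◃ zl ▮ [] ⟩
  marking []           []       = refl then done
  marking (false ∷ bs) (x ∷ xs) = refl then marking bs xs
  marking (true  ∷ bs) (x ∷ xs) = refl then markingTail (Vec.map bit bs) xs

  -- After the marking only the length of the clock matters, so its contents are left existential.
  -- The clock has at least one cell, which tells the end of the matrix from the end of a row.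
  markingRows : ∀ {f k m pl yl zl} (bs : Vec Bool (suc m)) (rs : Vec (Vec Cell (suc m)) k) → ∃ λ cs →
    ⟨ (markA , f) , pl ▮ rs ▸ [] , clock (Vec.map bit bs) , yl ▮ [] , zl ▮ [] ⟩ ⟶[ markingCost (suc m) k ]
    ⟨ (copy , f) , retreat (markRows bs rs ◂ pl ▮ ∅ ∷ []) , clock {suc m} cs ,
      retreat (markRows bs rs ◂ yl ▮ ∅ ∷ []) , retreat (markRows bs rs ◂ zl ▮ ∅ ∷ []) ⟩
  markingRows bs@(_ ∷ _) [] = Vec.map bit bs , refl then done
  markingRows bs (r ∷ rs) with cs , marks ← markingRows (tick bs) rs =
    cs , marking bs r ⨾ rewindClock refl refl (Vec.map bit (tick bs)) marks

  -- The cells are listed from last to first, as the heads meet them; `ys` and `zs` are overwritten.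
  copyingCells : ∀ {f k pl r c r′ r″} (xs ys zs : Vec Cell k) →
    ⟨ (copy , f) , retreat (xs ▹ ∅ ∷ pl ▮ r) , c , retreat (ys ▹ ∅ ∷ [] ▮ r′) , retreat (zs ▹ ∅ ∷ [] ▮ r″) ⟩ ⟶[ k + 1 ]
    ⟨ (scan , false , false , false) , ∅ ∷ pl ▮ xs ◃ r , c , ∅ ∷ [] ▮ xs ◃ r′ , ∅ ∷ [] ▮ xs ◃ r″ ⟩
  copyingCells []       []       []       = refl then done
  copyingCells (x ∷ xs) (y ∷ ys) (z ∷ zs) = refl then copyingCells xs ys zs

  scanning : ∀ {k h c b l x r cl cr yl yr zl zr} (cs ys zs : Vec Cell k) →
    ⟨ (scan , h , c , b) , l ▮ just x ∷ r , cl ▮ cs ▹ cr , yl ▮ ys ▹ yr , zl ▮ zs ▹ zr ⟩ ⟶[ k ]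
    ⟨ (scan , orFrom h (zipWith (bad x) ys zs) , c , b) , l ▮ just x ∷ r , cs ◃ cl ▮ cr , ys ◃ yl ▮ yr , zs ◃ zl ▮ zr ⟩
  scanning []       []       []       = done
  scanning (c ∷ cs) (y ∷ ys) (z ∷ zs) = refl then scanning cs ys zs

  -- The empty list and a single blank describe the same tape but are different lists, and a move
  -- can turn the former into the latter. This equation says that nothing of the kind happens.
  NonEmpty : List Γ → Set
  NonEmpty l = head l ∷ tail l ≡ l

  nonEmpty-◃ : ∀ {k} (xs : Vec Cell k) {l} → NonEmpty l → NonEmpty (xs ◃ l)
  nonEmpty-◃ []       p = p
  nonEmpty-◃ (x ∷ xs) _ = nonEmpty-◃ xs refl

  flatten : ∀ {k n} → Vec (Vec Cell n) k → Vec Cell (k * n)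
  flatten rs = reverse (concat rs)

  flatten-▹ : ∀ {k n} (rs : Vec (Vec Cell n) k) l → flatten rs ▹ l ≡ rs ◂ l
  flatten-▹ rs l = trans (reverse-▹ (concat rs) l) (concat-◃ rs l)

  flatten-◃ : ∀ {k n} (rs : Vec (Vec Cell n) k) l → flatten rs ◃ l ≡ rs ▸ l
  flatten-◃ rs l = trans (reverse-◃ (concat rs) l) (concat-▹ rs l)

  copying : ∀ {f k n pl c} (rs rs′ rs″ : Vec (Vec Cell n) k) →
    ⟨ (copy , f) , retreat (rs ◂ ∅ ∷ pl ▮ ∅ ∷ []) , c , retreat (rs′ ◂ ∅ ∷ [] ▮ ∅ ∷ []) , retreat (rs″ ◂ ∅ ∷ [] ▮ ∅ ∷ []) ⟩ ⟶[ k * n + 1 ]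
    ⟨ (scan , false , false , false) , ∅ ∷ pl ▮ rs ▸ ∅ ∷ [] , c , ∅ ∷ [] ▮ rs ▸ ∅ ∷ [] , ∅ ∷ [] ▮ rs ▸ ∅ ∷ [] ⟩
  copying {f} {k} {n} {pl} {c} rs rs′ rs″ =
    subst₂ (_⟶[ k * n + 1 ]_) before-≡ after-≡ (copyingCells (flatten rs) (flatten rs′) (flatten rs″))
    where
    from : (l l′ l″ : List Γ) → Config
    from l l′ l″ = ⟨ (copy , f) , retreat (l ▮ ∅ ∷ []) , c , retreat (l′ ▮ ∅ ∷ []) , retreat (l″ ▮ ∅ ∷ []) ⟩

    to : List Γ → Config
    to r = ⟨ (scan , false , false , false) , ∅ ∷ pl ▮ r , c , ∅ ∷ [] ▮ r , ∅ ∷ [] ▮ r ⟩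

    before-≡ : from (flatten rs ▹ ∅ ∷ pl) (flatten rs′ ▹ ∅ ∷ []) (flatten rs″ ▹ ∅ ∷ [])
             ≡ from (rs ◂ ∅ ∷ pl) (rs′ ◂ ∅ ∷ []) (rs″ ◂ ∅ ∷ [])
    before-≡ rewrite flatten-▹ rs (∅ ∷ pl) | flatten-▹ rs′ (∅ ∷ []) | flatten-▹ rs″ (∅ ∷ []) = refl

    after-≡ : to (flatten rs ◃ ∅ ∷ []) ≡ to (rs ▸ ∅ ∷ [])
    after-≡ = cong to (flatten-◃ rs (∅ ∷ []))

  backing : ∀ {k f z₁ z₄ yl yr} (cs ys : Vec Cell k) → NonEmpty yl →
    ⟨ (back , f) , z₁ , retreat (expired cs) , retreat (ys ◃ yl ▮ yr) , z₄ ⟩ ⟶[ k + 1 ]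
    ⟨ (scan , f) , z₁ , clock cs , yl ▮ ys ▹ yr , z₄ ⟩
  backing {k} {f} {z₁} {z₄} {yl} {yr} cs ys nonEmpty =
    subst₂ (_⟶[ k + 1 ]_) from-≡ to-≡ (walk (reverse cs) (reverse ys) (∅ ∷ []) yr)
    where
    from to : Zipper → Zipper → Config
    from z₂ z₃ = ⟨ (back , f) , z₁ , retreat z₂ , retreat z₃ , z₄ ⟩
    to   z₂ z₃ = ⟨ (scan , f) , z₁ , z₂ , z₃ , z₄ ⟩

    walk : ∀ {k} (xs ys : Vec Cell k) r r′ →
      from (xs ▹ ∅ ∷ [] ▮ r) (ys ▹ yl ▮ r′) ⟶[ k + 1 ] to (∅ ∷ [] ▮ xs ◃ r) (head yl ∷ tail yl ▮ ys ◃ r′)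
    walk []       []       r r′ = refl then done
    walk (x ∷ xs) (y ∷ ys) r r′ = refl then walk xs ys (just x ∷ r) (just y ∷ r′)

    from-≡ : from (reverse cs ▹ ∅ ∷ [] ▮ ∅ ∷ []) (reverse ys ▹ yl ▮ yr) ≡ from (expired cs) (ys ◃ yl ▮ yr)
    from-≡ rewrite reverse-▹ cs (∅ ∷ []) | reverse-▹ ys yl = refl

    to-≡ : to (∅ ∷ [] ▮ reverse cs ◃ ∅ ∷ []) (head yl ∷ tail yl ▮ reverse ys ◃ yr) ≡ to (clock cs) (yl ▮ ys ▹ yr)
    to-≡ rewrite reverse-◃ cs (∅ ∷ []) | reverse-◃ ys yr | nonEmpty = refl

  rewindingColumns : ∀ {f z₁ z₂ z₃ k n} (rs : Vec (Vec Cell n) k) →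
    ⟨ (rewindCol , f) , z₁ , z₂ , z₃ , retreat (rs ◂ ∅ ∷ [] ▮ ∅ ∷ []) ⟩ ⟶[ k * n + 1 ]
    ⟨ (rewindScan , f) , z₁ , apply ◀ z₂ , z₃ , ∅ ∷ [] ▮ rs ▸ ∅ ∷ [] ⟩
  rewindingColumns {f} {z₁} {z₂} {z₃} {k} {n} rs =
    subst₂ (λ l r → from (l ▮ ∅ ∷ []) ⟶[ k * n + 1 ] to (∅ ∷ [] ▮ r))
      (flatten-▹ rs _) (flatten-◃ rs _) (walk (flatten rs) _)
    where
    from to : Zipper → Config
    from z = ⟨ (rewindCol , f) , z₁ , z₂ , z₃ , retreat z ⟩
    to   z = ⟨ (rewindScan , f) , z₁ , apply ◀ z₂ , z₃ , z ⟩

    walk : ∀ {k} (xs : Vec Cell k) r → from (xs ▹ ∅ ∷ [] ▮ r) ⟶[ k + 1 ] to (∅ ∷ [] ▮ xs ◃ r)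
    walk []       r = refl then done
    walk (x ∷ xs) r = refl then walk xs (just x ∷ r)

  hit : ∀ {n} → Vec Cell n → Cell → Vec Cell n → Bool
  hit row x col = orFrom false (zipWith (bad x) row col)

  flags : ∀ {k n} → (Bool → Cell → Bool) → Vec Cell n → Vec Cell k → Vec (Vec Cell n) k → Vec Bool k
  flags f row = zipWith (λ x col → f (hit row x col) x)

  raiseRow : ∀ {k n} → Vec Cell n → Vec Cell k → Vec (Vec Cell n) k → Vec Cell k
  raiseRow row = zipWith (λ x col → raise (hit row x col) x)

  changes conflicts : Bool → Cell → Bool
  changes   h x = h ∧ isCold x
  conflicts h x = h ∧ not (isCold x)

  rowPass : ∀ {k m c b pl pr yl yr zl} (cs row : Vec Cell (suc m)) (xs : Vec Cell (suc k)) (cols : Vec (Vec Cell (suc m)) (suc k)) →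
    NonEmpty yl → NonEmpty yr →
    ⟨ (scan , false , c , b) , pl ▮ xs ▹ pr , clock cs , yl ▮ row ▹ yr , zl ▮ cols ▸ ∅ ∷ [] ⟩ ⟶[ rowCost (suc m) k ]
    ⟨ (next , false , orFrom c (flags changes row xs cols) , orFrom b (flags conflicts row xs cols)) ,
      raiseRow row xs cols ◃ pl ▮ pr , expired cs , row ◃ yl ▮ yr , cols ◂ zl ▮ ∅ ∷ [] ⟩
  rowPass cs row (x ∷ []) (col ∷ []) _ _ = scanning cs row col ⨾ refl then done
  -- The next column is split to show its first cell `z`, which makes `δ` choose `back` and not
  -- `next`.
  rowPass {suc k} {m} {c} {b} {pl} {pr} {yl} {yr} {zl} cs row (x ∷ x′ ∷ xs) (col ∷ (z ∷ col′) ∷ cols) yl-ok yr-ok =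
    scanning cs row col ⨾
    cong (λ r → inj₂ ⟨ (back , false , c ∨ changes h x , b ∨ conflicts h x) ,
                     just (raise h x) ∷ pl ▮ just x′ ∷ xs ▹ pr , retreat (expired cs) ,
                     tail (row ◃ yl) ▮ head (row ◃ yl) ∷ r , col ◃ zl ▮ just z ∷ col′ ▹ cols ▸ ∅ ∷ [] ⟩) yr-ok
    then backing cs row yl-ok ⨾ rowPass cs row (x′ ∷ xs) ((z ∷ col′) ∷ cols) yl-ok yr-ok
    where h = hit row x col

  flagRows : ∀ {k n} → (Bool → Cell → Bool) → Vec (Vec Cell n) n → Vec (Vec Cell n) k → Vec (Vec Bool n) k
  flagRows f cols = Vec.map (λ row → flags f row row cols)

  orRowsFrom : ∀ {k n} → Bool → Vec (Vec Bool n) k → Bool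
  orRowsFrom h []         = h
  orRowsFrom h (xs ∷ xss) = orRowsFrom (orFrom h xs) xss

  raiseRows : ∀ {k n} → Vec (Vec Cell n) n → Vec (Vec Cell n) k → Vec (Vec Cell n) k
  raiseRows cols = Vec.map (λ row → raiseRow row row cols)

  -- The first and third tapes start with the same remaining `rows`: only cells already passed have
  -- been raised, and hits are computed from the copies. Hence the pass amounts to `raiseRows`.
  passRows : ∀ {k m c b pl yl} (cs : Vec Cell (suc m)) (cols : Vec (Vec Cell (suc m)) (suc m)) (rows : Vec (Vec Cell (suc m)) (suc k)) →
    NonEmpty yl →
    ⟨ (scan , false , c , b) , pl ▮ rows ▸ ∅ ∷ [] , clock cs , yl ▮ rows ▸ ∅ ∷ [] , ∅ ∷ [] ▮ cols ▸ ∅ ∷ [] ⟩ ⟶[ passCost m k ]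
    ⟨ (next , false , orRowsFrom c (flagRows changes cols rows) , orRowsFrom b (flagRows conflicts cols rows)) ,
      raiseRows cols rows ◂ pl ▮ ∅ ∷ [] , expired cs , rows ◂ yl ▮ ∅ ∷ [] , cols ◂ ∅ ∷ [] ▮ ∅ ∷ [] ⟩
  passRows cs cols (row ∷ []) yl-ok = rowPass cs row row cols yl-ok refl
  passRows cs cols (row ∷ (x ∷ row′) ∷ rows) yl-ok =
    rowPass cs row row cols yl-ok refl ⨾ refl then rewindingColumns cols ⨾
    rewindClock refl refl cs (passRows cs cols ((x ∷ row′) ∷ rows) (nonEmpty-◃ row yl-ok))

  passStart : ∀ {m} → List Γ → Vec Cell (suc m) → Vec (Vec Cell (suc m)) (suc m) → Config
  passStart pl cs rows =
    ⟨ (scan , false , false , false) , ∅ ∷ pl ▮ rows ▸ ∅ ∷ [] , clock cs , ∅ ∷ [] ▮ rows ▸ ∅ ∷ [] , ∅ ∷ [] ▮ rows ▸ ∅ ∷ [] ⟩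

  raiseAll : ∀ {n} → Vec (Vec Cell n) n → Vec (Vec Cell n) n
  raiseAll rows = raiseRows rows rows

  changed conflicting : ∀ {n} → Vec (Vec Cell n) n → Bool
  changed     rows = orRowsFrom false (flagRows changes rows rows)
  conflicting rows = orRowsFrom false (flagRows conflicts rows rows)

  roundChanged : ∀ {m pl} (cs : Vec Cell (suc m)) rows → changed rows ≡ true →
                 passStart pl cs rows ⟶[ roundCost m ] passStart pl cs (raiseAll rows)
  roundChanged {m} {pl} cs rows eq =
    passRows cs rows rows refl ⨾
    cong (λ c → step ⟨ (next , false , c , conflicting rows) , raiseAll rows ◂ ∅ ∷ pl ▮ ∅ ∷ [] , expired cs ,
                      rows ◂ ∅ ∷ [] ▮ ∅ ∷ [] , rows ◂ ∅ ∷ [] ▮ ∅ ∷ [] ⟩) eq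
    then rewindClock refl refl cs (copying (raiseAll rows) rows rows)

  roundUnchanged : ∀ {m pl} (cs : Vec Cell (suc m)) rows → changed rows ≡ false →
                   HaltsWith (not (conflicting rows)) (roundCost m) (passStart pl cs rows)
  roundUnchanged {m} {pl} cs rows eq =
    haltsAfter (passRows cs rows rows refl)
      (haltsNow (cong (λ c → step ⟨ (next , false , c , conflicting rows) , raiseAll rows ◂ ∅ ∷ pl ▮ ∅ ∷ [] , expired cs ,
                                    rows ◂ ∅ ∷ [] ▮ ∅ ∷ [] , rows ◂ ∅ ∷ [] ▮ ∅ ∷ [] ⟩) eq))

  setup : ∀ {f} m (rows : Vec (Vec Cell (suc m)) (suc m)) → ∃ λ pl → ∃ λ cs →
    ⟨ (start , f) , [] ▮ Vec.map bit (replicate (suc m) true) ▹ just (bit false) ∷ rows ▸ [] , [] ▮ [] , [] ▮ [] , [] ▮ [] ⟩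
    ⟶[ setupCost m ] passStart pl cs (markRows (replicate (suc m) true) rows)
  setup m rows with cs , marks ← markingRows (replicate (suc m) true) rows =
    _ , cs , starting m (rows ▸ []) ⨾
      rewindClock refl refl (Vec.map bit (replicate (suc m) true)) (marks ⨾ copying marked marked marked)
    where marked = markRows (replicate (suc m) true) rows

-- Disjunctions and sums over vectors.

∧-true : ∀ p {q} → p ∧ q ≡ true → p ≡ true × q ≡ true
∧-true true eq = refl , eq

orFrom-true : ∀ {k} h (xs : Vec Bool k) → orFrom h xs ≡ true → h ≡ true ⊎ ∃ λ i → lookup xs i ≡ true
orFrom-true h []       eq = inj₁ eq
orFrom-true h (x ∷ xs) eq with orFrom-true (h ∨ x) xs eq
orFrom-true true  (x ∷ xs) eq | inj₁ _       = inj₁ refl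
orFrom-true false (x ∷ xs) eq | inj₁ p       = inj₂ (zero , p)
orFrom-true h     (x ∷ xs) eq | inj₂ (i , p) = inj₂ (suc i , p)

orFrom-false : ∀ {k} h (xs : Vec Bool k) → orFrom h xs ≡ false → h ≡ false × ∀ i → lookup xs i ≡ false
orFrom-false h []       eq = eq , λ ()
orFrom-false h (x ∷ xs) eq with orFrom-false (h ∨ x) xs eq
orFrom-false false (x ∷ xs) eq | p , ps = refl , λ { zero → p ; (suc i) → ps i }

sum-mono-≤ : ∀ {k} (xs ys : Vec ℕ k) → (∀ i → lookup xs i ≤ lookup ys i) → sum xs ≤ sum ys
sum-mono-≤ []       []       _ = z≤n
sum-mono-≤ (x ∷ xs) (y ∷ ys) p = +-mono-≤ (p zero) (sum-mono-≤ xs ys (p ∘ suc))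

sum-mono-< : ∀ {k} (xs ys : Vec ℕ k) → (∀ i → lookup xs i ≤ lookup ys i) →
             ∀ i → lookup xs i < lookup ys i → sum xs < sum ys
sum-mono-< (x ∷ xs) (y ∷ ys) p zero    q = +-mono-<-≤ q (sum-mono-≤ xs ys (p ∘ suc))
sum-mono-< (x ∷ xs) (y ∷ ys) p (suc i) q = +-mono-≤-< (p zero) (sum-mono-< xs ys (p ∘ suc) i q)

sum-bounded : ∀ {k} b (xs : Vec ℕ k) → (∀ i → lookup xs i ≤ b) → sum xs ≤ k * b
sum-bounded b []       _ = z≤n
sum-bounded b (x ∷ xs) p = +-mono-≤ (p zero) (sum-bounded b xs (p ∘ suc))

-- The diagonal marks.

ticks : (n : ℕ) → ℕ → Vec Bool n
ticks zero    j       = []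
ticks (suc n) zero    = true  ∷ ticks n zero
ticks (suc n) (suc j) = false ∷ ticks n j

ticks-zero : ∀ n → ticks n 0 ≡ replicate n true
ticks-zero zero    = refl
ticks-zero (suc n) = cong (true ∷_) (ticks-zero n)

tick-ticks : ∀ n j → tick (ticks n j) ≡ ticks n (suc j)
tick-ticks zero    j       = refl
tick-ticks (suc n) zero    = refl
tick-ticks (suc n) (suc j) = cong (false ∷_) (tick-ticks n j)

lookup-markRow : ∀ n j (xs : Vec Cell n) v →
                 lookup (markRow (ticks n j) xs) v ≡ (if j ≡ᵇ toℕ v then dia else lookup xs v)
lookup-markRow (suc n) zero    (x ∷ xs) zero    = refl
lookup-markRow (suc n) zero    (x ∷ xs) (suc v) = refl
lookup-markRow (suc n) (suc j) (x ∷ xs) zero    = refl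
lookup-markRow (suc n) (suc j) (x ∷ xs) (suc v) = lookup-markRow n j xs v

-- Generalised over the state `j` of the clock, because the recursion ticks it at every row.
lookup-markRows : ∀ {k} n j (rows : Vec (Vec Cell n) k) u →
                  lookup (markRows (ticks n j) rows) u ≡ markRow (ticks n (toℕ u + j)) (lookup rows u)
lookup-markRows n j (r ∷ rows) zero    = refl
lookup-markRows n j (r ∷ rows) (suc u) rewrite tick-ticks n j | sym (+-suc (toℕ u) j) = lookup-markRows n (suc j) rows u

≡ᵇ-≟ : ∀ {n} (u v : Fin n) → (toℕ u ≡ᵇ toℕ v) ≡ does (u Fin.≟ v)
≡ᵇ-≟ zero    zero    = refl
≡ᵇ-≟ zero    (suc v) = refl
≡ᵇ-≟ (suc u) zero    = refl
≡ᵇ-≟ (suc u) (suc v) = ≡ᵇ-≟ u v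

cellAt : ∀ {k n} → Vec (Vec Cell n) k → Fin k → Fin n → Cell
cellAt rows u v = lookup (lookup rows u) v

cellAt-markRows : ∀ {n} (rows : Vec (Vec Cell n) n) u v →
  cellAt (markRows (replicate n true) rows) u v ≡ (if does (u Fin.≟ v) then dia else cellAt rows u v)
cellAt-markRows {n} rows u v
  rewrite sym (ticks-zero n) | lookup-markRows n 0 rows u | +-identityʳ (toℕ u) | sym (≡ᵇ-≟ u v) =
  lookup-markRow n (toℕ u) (lookup rows u) v

-- Heating, erasure and the number of cold cells.

isCold-true : ∀ x → isCold x ≡ true → x ≡ bit true
isCold-true (bit true) _ = refl

isCold-false : ∀ x → isCold x ≡ false → x ≢ bit true
isCold-false (bit false) _ ()
isCold-false dia         _ ()
isCold-false hot         _ ()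

erase : Cell → Cell
erase hot = bit true
erase x   = x

erase-raise : ∀ h x → erase (raise h x) ≡ erase x
erase-raise false _           = refl
erase-raise true  (bit false) = refl
erase-raise true  (bit true)  = refl
erase-raise true  dia         = refl
erase-raise true  hot         = refl

raise-hot : ∀ h x → raise h x ≡ hot → x ≡ hot ⊎ h ≡ true × x ≡ bit true
raise-hot false _          eq = inj₁ eq
raise-hot true  (bit true) eq = inj₂ (refl , refl)
raise-hot true  hot        eq = inj₁ refl

erase-cold : ∀ x → erase x ≡ bit true → x ≡ bit true ⊎ x ≡ hot
erase-cold (bit true) _ = inj₁ refl
erase-cold hot        _ = inj₂ refl

erase-injective : ∀ x y → y ≢ bit true → y ≢ hot → erase x ≡ erase y → x ≡ y
erase-injective x          (bit true)  p _ _  = contradiction refl p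
erase-injective x          hot         _ q _  = contradiction refl q
erase-injective (bit true) (bit false) _ _ ()
erase-injective (bit _)    (bit false) _ _ eq = eq
erase-injective dia        (bit false) _ _ ()
erase-injective hot        (bit false) _ _ ()
erase-injective (bit _)    dia         _ _ ()
erase-injective dia        dia         _ _ _  = refl
erase-injective hot        dia         _ _ ()

weight : Cell → ℕ
weight (bit true) = 1
weight _          = 0

weight≤1 : ∀ x → weight x ≤ 1
weight≤1 (bit false) = z≤n
weight≤1 (bit true)  = ≤-refl
weight≤1 dia         = z≤n
weight≤1 hot         = z≤n

weight-raise : ∀ h x → weight (raise h x) ≤ weight x
weight-raise false x           = ≤-refl
weight-raise true  (bit false) = ≤-refl
weight-raise true  (bit true)  = z≤n
weight-raise true  dia         = ≤-refl
weight-raise true  hot         = ≤-refl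

-- The sum of these is the termination measure of the rounds.
coldCells : ∀ {k n} → Vec (Vec Cell n) k → Vec ℕ k
coldCells = Vec.map (λ row → sum (Vec.map weight row))

coldCells≤ : ∀ {k n} (rows : Vec (Vec Cell n) k) → sum (coldCells rows) ≤ k * (n * 1)
coldCells≤ {n = n} rows = sum-bounded (n * 1) (coldCells rows) λ i → subst (_≤ n * 1) (sym (lookup-map i _ rows))
  (sum-bounded 1 (Vec.map weight (lookup rows i)) λ j →
    subst (_≤ 1) (sym (lookup-map j _ (lookup rows i))) (weight≤1 (cellAt rows i j)))

module _ {n : ℕ} (rows rows′ : Vec (Vec Cell n) n)
         (lighter : ∀ u v → weight (cellAt rows′ u v) ≤ weight (cellAt rows u v)) where

  private
    lighterAt : ∀ u v → lookup (Vec.map weight (lookup rows′ u)) v ≤ lookup (Vec.map weight (lookup rows u)) v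
    lighterAt u v = subst₂ _≤_ (sym (lookup-map v _ (lookup rows′ u))) (sym (lookup-map v _ (lookup rows u))) (lighter u v)

  coldCells-mono-< : ∀ u v → weight (cellAt rows′ u v) < weight (cellAt rows u v) →
                     sum (coldCells rows′) < sum (coldCells rows)
  coldCells-mono-< u v p = sum-mono-< (coldCells rows′) (coldCells rows)
    (λ i → subst₂ _≤_ (sym (lookup-map i _ rows′)) (sym (lookup-map i _ rows))
             (sum-mono-≤ (Vec.map weight (lookup rows′ i)) (Vec.map weight (lookup rows i)) (lighterAt i)))
    u (subst₂ _<_ (sym (lookup-map u _ rows′)) (sym (lookup-map u _ rows))
        (sum-mono-< (Vec.map weight (lookup rows′ u)) (Vec.map weight (lookup rows u)) (lighterAt u) v
          (subst₂ _<_ (sym (lookup-map v _ (lookup rows′ u))) (sym (lookup-map v _ (lookup rows u))) p)))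

-- Horn predicates and the correctness of the rounds.

-- The arguments of `bad` are the cells uv, uw, vw.
record Horn (bad : Cell → Cell → Cell → Bool) : Set where
  field
    swap₁₂ : ∀ x y z → bad x y z ≡ bad y x z
    swap₂₃ : ∀ x y z → bad x y z ≡ bad x z y
    cold   : ∀ y z → bad (bit true) y z ≡ true → y ≢ bit true × z ≢ bit true

-- N codes a colouring of the graph with cells A.
record Solution (bad : Cell → Cell → Cell → Bool) {n} (A N : Fin n → Fin n → Cell) : Set where
  field
    symmetric  : ∀ u v → N u v ≡ N v u
    underlying : ∀ u v → erase (N u v) ≡ A u v
    free       : ∀ u v w → bad (N u v) (N u w) (N v w) ≡ false

module Correctness (bad : Cell → Cell → Cell → Bool) (horn : Horn bad) where
  open Decider bad
  open Horn horn

  hitAt : ∀ {n} → Vec (Vec Cell n) n → Fin n → Fin n → Bool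
  hitAt rows u v = hit (lookup rows u) (cellAt rows u v) (lookup rows v)

  cellAt-raiseAll : ∀ {n} (rows : Vec (Vec Cell n) n) u v →
                    cellAt (raiseAll rows) u v ≡ raise (hitAt rows u v) (cellAt rows u v)
  cellAt-raiseAll rows u v =
    trans (cong (λ r → lookup r v) (lookup-map u (λ row → raiseRow row row rows) rows))
          (lookup-zipWith _ v (lookup rows u) rows)

  hitAt-true : ∀ {n} (rows : Vec (Vec Cell n) n) u v → hitAt rows u v ≡ true →
               ∃ λ w → bad (cellAt rows u v) (cellAt rows u w) (cellAt rows v w) ≡ true
  hitAt-true rows u v eq with orFrom-true false (zipWith (bad _) (lookup rows u) (lookup rows v)) eq
  ... | inj₂ (w , p) = w , trans (sym (lookup-zipWith _ w (lookup rows u) (lookup rows v))) p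

  hitAt-false : ∀ {n} (rows : Vec (Vec Cell n) n) u v → hitAt rows u v ≡ false →
                ∀ w → bad (cellAt rows u v) (cellAt rows u w) (cellAt rows v w) ≡ false
  hitAt-false rows u v eq w =
    trans (sym (lookup-zipWith _ w (lookup rows u) (lookup rows v)))
          (proj₂ (orFrom-false false (zipWith (bad _) (lookup rows u) (lookup rows v)) eq) w)

  hitAt-intro : ∀ {n} (rows : Vec (Vec Cell n) n) u v w →
                bad (cellAt rows u v) (cellAt rows u w) (cellAt rows v w) ≡ true → hitAt rows u v ≡ true
  hitAt-intro rows u v w p with hitAt rows u v in eq
  ... | true  = refl
  ... | false = trans (sym (hitAt-false rows u v eq w)) p

  orRowsFrom-true : ∀ {k n} h (xss : Vec (Vec Bool n) k) → orRowsFrom h xss ≡ true →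
                    h ≡ true ⊎ ∃ λ i → ∃ λ j → lookup (lookup xss i) j ≡ true
  orRowsFrom-true h []         eq = inj₁ eq
  orRowsFrom-true h (xs ∷ xss) eq with orRowsFrom-true (orFrom h xs) xss eq
  ... | inj₂ (i , j , p) = inj₂ (suc i , j , p)
  ... | inj₁ p with orFrom-true h xs p
  ...   | inj₁ q       = inj₁ q
  ...   | inj₂ (j , q) = inj₂ (zero , j , q)

  orRowsFrom-false : ∀ {k n} h (xss : Vec (Vec Bool n) k) → orRowsFrom h xss ≡ false →
                     h ≡ false × ∀ i j → lookup (lookup xss i) j ≡ false
  orRowsFrom-false h []         eq = eq , λ ()
  orRowsFrom-false h (xs ∷ xss) eq with orRowsFrom-false (orFrom h xs) xss eq
  ... | p , ps with orFrom-false h xs p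
  ...   | q , qs = q , λ { zero j → qs j ; (suc i) j → ps i j }

  lookup-flagRows : ∀ {n} f (rows : Vec (Vec Cell n) n) u v →
                    lookup (lookup (flagRows f rows rows) u) v ≡ f (hitAt rows u v) (cellAt rows u v)
  lookup-flagRows f rows u v =
    trans (cong (λ r → lookup r v) (lookup-map u (λ row → flags f row row rows) rows))
          (lookup-zipWith _ v (lookup rows u) rows)

  flagged : ∀ {n} f (rows : Vec (Vec Cell n) n) → orRowsFrom false (flagRows f rows rows) ≡ true →
            ∃ λ u → ∃ λ v → f (hitAt rows u v) (cellAt rows u v) ≡ true
  flagged f rows eq with orRowsFrom-true false (flagRows f rows rows) eq
  ... | inj₂ (u , v , p) = u , v , trans (sym (lookup-flagRows f rows u v)) p

  unflagged : ∀ {n} f (rows : Vec (Vec Cell n) n) → orRowsFrom false (flagRows f rows rows) ≡ false →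
              ∀ u v → f (hitAt rows u v) (cellAt rows u v) ≡ false
  unflagged f rows eq u v =
    trans (sym (lookup-flagRows f rows u v)) (proj₂ (orRowsFrom-false false (flagRows f rows rows) eq) u v)

  module _ {n : ℕ} (A : Fin n → Fin n → Cell) where

    -- The invariant of the rounds. `hotOnly` speaks of all solutions at once, vacuously if there
    -- are none, so a final matrix that is a solution is the least one.
    record Below (rows : Vec (Vec Cell n) n) : Set where
      field
        symmetric  : ∀ u v → cellAt rows u v ≡ cellAt rows v u
        underlying : ∀ u v → erase (cellAt rows u v) ≡ A u v
        hotOnly    : ∀ {N} → Solution bad A N → ∀ u v → cellAt rows u v ≡ hot → N u v ≡ hot

    module _ {rows : Vec (Vec Cell n) n} (below : Below rows) where
      open Below below

      -- A hot cell is settled by `hotOnly`; a non-edge or diagonal cell is determined by its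
      -- erasure, which matrix and solution share. Only cold cells leave a choice.
      agree : ∀ {N} → Solution bad A N → ∀ u v → cellAt rows u v ≢ bit true → N u v ≡ cellAt rows u v
      agree {N} sol u v notCold with cellAt rows u v in eq
      ... | hot         = hotOnly sol u v eq
      ... | bit true    = contradiction refl notCold
      ... | bit false   = erase-injective _ _ notCold (λ ())
                            (trans (Solution.underlying sol u v) (trans (sym (underlying u v)) (cong erase eq)))
      ... | dia         = erase-injective _ _ notCold (λ ())
                            (trans (Solution.underlying sol u v) (trans (sym (underlying u v)) (cong erase eq)))

      -- Exchanging `u` and `v` exchanges the cells `uw` and `vw`, which `swap₂₃` permits. This
      -- keeps the matrix symmetric.
      hitAt-sym : ∀ u v → hitAt rows u v ≡ hitAt rows v u
      hitAt-sym u v = trans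
        (cong (λ x → hit (lookup rows u) x (lookup rows v)) (symmetric u v))
        (cong (orFrom false) (zipWith-comm (λ y z → swap₂₃ _ y z) (lookup rows u) (lookup rows v)))

      raiseAll-below : Below (raiseAll rows)
      raiseAll-below = record
        { symmetric  = λ u v → trans (cellAt-raiseAll rows u v)
            (trans (cong₂ raise (hitAt-sym u v) (symmetric u v)) (sym (cellAt-raiseAll rows v u)))
        ; underlying = λ u v → trans (cong erase (cellAt-raiseAll rows u v))
            (trans (erase-raise (hitAt rows u v) (cellAt rows u v)) (underlying u v))
        ; hotOnly    = hotOnly′
        }
        where
        hotOnly′ : ∀ {N} → Solution bad A N → ∀ u v → cellAt (raiseAll rows) u v ≡ hot → N u v ≡ hot
        hotOnly′ {N} sol u v eq with raise-hot _ (cellAt rows u v) (trans (sym (cellAt-raiseAll rows u v)) eq)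
        ... | inj₁ p = hotOnly sol u v p
        ... | inj₂ (h , isCold) with hitAt-true rows u v h
        -- Since `uv` is cold, the other two cells are not, and `N` agrees with them. A cold `N u v`
        -- would complete a forbidden triple in `N`.
        ...   | w , b with cold _ _ (trans (cong (λ x → bad x _ _) (sym isCold)) b)
        ...     | p , q with erase-cold (N u v) (trans (Solution.underlying sol u v) (trans (sym (underlying u v)) (cong erase isCold)))
        ...       | inj₂ r = r
        ...       | inj₁ r = contradiction
          (trans (sym (Solution.free sol u v w))
            (trans (cong₂ (bad (N u v)) (agree sol u w p) (agree sol v w q))
              (trans (cong (λ x → bad x _ _) (trans r (sym isCold))) b)))
          λ ()

      changed-decreases : changed rows ≡ true → sum (coldCells (raiseAll rows)) < sum (coldCells rows)
      changed-decreases eq with flagged changes rows eq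
      ... | u , v , p with ∧-true _ p
      ...   | h , c = coldCells-mono-< rows (raiseAll rows)
        (λ u v → subst (λ x → weight x ≤ weight (cellAt rows u v)) (sym (cellAt-raiseAll rows u v)) (weight-raise _ (cellAt rows u v)))
        u v (subst₂ _<_
          (cong weight (sym (trans (cellAt-raiseAll rows u v) (cong₂ raise h (isCold-true _ c)))))
          (cong weight (sym (isCold-true _ c))) ≤-refl)

      module _ (unchanged : changed rows ≡ false) where

        -- A hit at a cold cell would have set the `changes` flag.
        hit⇒notCold : ∀ u v w → bad (cellAt rows u v) (cellAt rows u w) (cellAt rows v w) ≡ true → cellAt rows u v ≢ bit true
        hit⇒notCold u v w b = isCold-false _
          (trans (cong (_∧ isCold (cellAt rows u v)) (sym (hitAt-intro rows u v w b))) (unflagged changes rows unchanged u v))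

        -- Every cell is cold or not, so a hit would set one of the two flags. The edges that are
        -- still cold simply stay cold.
        accept : conflicting rows ≡ false → Solution bad A (cellAt rows)
        accept eq = record
          { symmetric  = symmetric
          ; underlying = underlying
          ; free       = λ u v → hitAt-false rows u v
              (noFlag _ _ (unflagged changes rows unchanged u v) (unflagged conflicts rows eq u v))
          }
          where
          noFlag : ∀ h c → h ∧ c ≡ false → h ∧ not c ≡ false → h ≡ false
          noFlag false _     _ _ = refl
          noFlag true  false _ ()

        -- By the symmetry of `bad` the triple is a hit at each of its three cells, so none of them
        -- is cold and every solution contains the triple unchanged.
        reject : conflicting rows ≡ true → ∀ {N} → ¬ Solution bad A N
        reject eq {N} sol with flagged conflicts rows eq
        ... | u , v , p with hitAt-true rows u v (proj₁ (∧-true _ p))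
        ...   | w , b = contradiction
          (trans (sym (Solution.free sol u v w))
            (trans (cong₂ (λ x y → bad x y (N v w)) (agree sol u v (hit⇒notCold u v w b)) (agree sol u w (hit⇒notCold u w v b′)))
              (trans (cong (bad _ _) (agree sol v w (hit⇒notCold v w u b″))) b)))
          λ ()
          where
          b′ : bad (cellAt rows u w) (cellAt rows u v) (cellAt rows w v) ≡ true
          b′ = trans (swap₁₂ _ _ _) (trans (cong (bad _ _) (symmetric w v)) b)

          b″ : bad (cellAt rows v w) (cellAt rows v u) (cellAt rows w u) ≡ true
          b″ = trans (cong₂ (bad _) (symmetric v u) (symmetric w u)) (trans (swap₁₂ _ _ _) (trans (swap₂₃ _ _ _) b))

  -- `k` bounds the cold cells and thus the rounds that heat something; the additional round is the
  -- one that halts. `haltsLater` absorbs the time left over by an early halt.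
  rounds : ∀ {m pl} (A : Fin (suc m) → Fin (suc m) → Cell) (cs : Vec Cell (suc m)) k rows → Below A rows →
           sum (coldCells rows) ≤ k →
           ∃ λ a → HaltsWith a (suc k * roundCost m) (passStart pl cs rows) × Reflects (∃ (Solution bad A)) a
  rounds A cs k rows below bound with changed rows in chg
  rounds A cs zero rows below bound | true with () ← ≤-trans (changed-decreases A below chg) bound
  rounds A cs (suc k) rows below bound | true
    with a , halting , reflects ← rounds A cs k (raiseAll rows) (raiseAll-below A below)
                                  (s≤s⁻¹ (≤-trans (changed-decreases A below chg) bound))
    = a , haltsAfter (roundChanged cs rows chg) halting , reflects
  rounds {m} A cs k rows below bound | false =
    not (conflicting rows) , haltsLater (roundUnchanged cs rows chg) (k * roundCost m) , reflects
    where
    reflects : Reflects (∃ (Solution bad A)) (not (conflicting rows))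
    reflects with conflicting rows in eq
    ... | true  = ofⁿ λ (_ , sol) → reject A below chg eq sol
    ... | false = ofʸ (_ , accept A below chg eq)

-- The time bound.

module TimeBound (m l : ℕ) (n≤ℓ : suc m ≤ suc l) (n²≤ℓ : suc m * suc m ≤ suc l) where
  open ≤-Reasoning

  private
    n ℓ : ℕ
    n = suc m
    ℓ = suc l

    1≤ℓ : 1 ≤ ℓ
    1≤ℓ = s≤s z≤n

  rowCost≤ : ∀ k → rowCost n k ≤ suc k * (n + suc (n + 1))
  rowCost≤ zero    = ≤-trans (m≤m+n (n + 1) (suc n)) (≤-reflexive (expand n))
    where
    expand : ∀ n → n + 1 + suc n ≡ 1 * (n + suc (n + 1))
    expand = solve-∀
  rowCost≤ (suc k) = ≤-trans (≤-reflexive (expand n (rowCost n k))) (+-monoʳ-≤ (n + suc (n + 1)) (rowCost≤ k))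
    where
    expand : ∀ n x → n + suc (n + 1 + x) ≡ n + suc (n + 1) + x
    expand = solve-∀

  rowCost≤4ℓ : rowCost n m ≤ 4 * ℓ
  rowCost≤4ℓ = begin
    rowCost n m              ≤⟨ rowCost≤ m ⟩
    n * (n + suc (n + 1))    ≡⟨ expand n ⟩
    2 * (n * n) + 2 * n      ≤⟨ +-mono-≤ (*-monoʳ-≤ 2 n²≤ℓ) (*-monoʳ-≤ 2 n≤ℓ) ⟩
    2 * ℓ + 2 * ℓ            ≡⟨ collect ℓ ⟩
    4 * ℓ                    ∎
    where
    expand : ∀ n → n * (n + suc (n + 1)) ≡ 2 * (n * n) + 2 * n
    expand = solve-∀

    collect : ∀ x → 2 * x + 2 * x ≡ 4 * x
    collect = solve-∀

  -- Per row: `4 * ℓ` for its entries, `ℓ` for the way back of the fourth head, `ℓ` for the clock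
  -- and `3 * ℓ` for three single steps.
  passCost≤ : ∀ k → passCost m k ≤ suc k * (9 * ℓ)
  passCost≤ zero    = begin
    rowCost n m         ≤⟨ rowCost≤4ℓ ⟩
    4 * ℓ               ≤⟨ m≤m+n (4 * ℓ) (5 * ℓ) ⟩
    4 * ℓ + 5 * ℓ       ≡⟨ collect ℓ ⟩
    1 * (9 * ℓ)         ∎
    where
    collect : ∀ x → 4 * x + 5 * x ≡ 1 * (9 * x)
    collect = solve-∀
  passCost≤ (suc k) = begin
    rowCost n m + suc (n * n + 1 + (n + suc (passCost m k)))
      ≡⟨ expand (rowCost n m) n (passCost m k) ⟩
    rowCost n m + (n * n + (n + 3)) + passCost m k
      ≤⟨ +-mono-≤ (+-mono-≤ rowCost≤4ℓ (+-mono-≤ n²≤ℓ (+-mono-≤ n≤ℓ (*-monoʳ-≤ 3 1≤ℓ)))) (passCost≤ k) ⟩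
    4 * ℓ + (ℓ + (ℓ + 3 * ℓ)) + suc k * (9 * ℓ)
      ≡⟨ collect ℓ k ⟩
    suc (suc k) * (9 * ℓ) ∎
    where
    expand : ∀ r n p → r + suc (n * n + 1 + (n + suc p)) ≡ r + (n * n + (n + 3)) + p
    expand = solve-∀

    collect : ∀ x k → 4 * x + (x + (x + 3 * x)) + suc k * (9 * x) ≡ suc (suc k) * (9 * x)
    collect = solve-∀

  roundCost≤ : roundCost m ≤ ℓ * (9 * ℓ) + 5 * ℓ
  roundCost≤ = begin
    passCost m m + suc (n + suc (n * n + 1))    ≡⟨ expand (passCost m m) n ⟩
    passCost m m + (n + (n * n + 3))
      ≤⟨ +-mono-≤ (≤-trans (passCost≤ m) (*-mono-≤ n≤ℓ ≤-refl)) (+-mono-≤ n≤ℓ (+-mono-≤ n²≤ℓ (*-monoʳ-≤ 3 1≤ℓ))) ⟩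
    ℓ * (9 * ℓ) + (ℓ + (ℓ + 3 * ℓ))             ≡⟨ collect ℓ ⟩
    ℓ * (9 * ℓ) + 5 * ℓ                         ∎
    where
    expand : ∀ p n → p + suc (n + suc (n * n + 1)) ≡ p + (n + (n * n + 3))
    expand = solve-∀

    collect : ∀ x → x * (9 * x) + (x + (x + 3 * x)) ≡ x * (9 * x) + 5 * x
    collect = solve-∀

  markingCost≤ : ∀ k → markingCost n k ≤ 1 + k * (2 * n + 2)
  markingCost≤ zero    = ≤-refl
  markingCost≤ (suc k) = begin
    n + 1 + (n + suc (markingCost n k))       ≡⟨ expand n (markingCost n k) ⟩
    2 * n + 2 + markingCost n k               ≤⟨ +-monoʳ-≤ (2 * n + 2) (markingCost≤ k) ⟩
    2 * n + 2 + (1 + k * (2 * n + 2))         ≡⟨ collect n k ⟩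
    1 + suc k * (2 * n + 2)                   ∎
    where
    expand : ∀ n x → n + 1 + (n + suc x) ≡ 2 * n + 2 + x
    expand = solve-∀

    collect : ∀ n k → 2 * n + 2 + (1 + k * (2 * n + 2)) ≡ 1 + suc k * (2 * n + 2)
    collect = solve-∀

  setupCost≤ : setupCost m ≤ 12 * ℓ
  setupCost≤ = begin
    1 + (n + 1) + (n + suc (markingCost n n + (n * n + 1)))
      ≤⟨ +-monoʳ-≤ (1 + (n + 1)) (+-monoʳ-≤ n (s≤s (+-mono-≤ (markingCost≤ n) ≤-refl))) ⟩
    1 + (n + 1) + (n + suc (1 + n * (2 * n + 2) + (n * n + 1)))
      ≡⟨ expand n ⟩
    3 * (n * n) + (4 * n + 5)
      ≤⟨ +-mono-≤ (*-monoʳ-≤ 3 n²≤ℓ) (+-mono-≤ (*-monoʳ-≤ 4 n≤ℓ) (*-monoʳ-≤ 5 1≤ℓ)) ⟩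
    3 * ℓ + (4 * ℓ + 5 * ℓ)
      ≡⟨ collect ℓ ⟩
    12 * ℓ ∎
    where
    expand : ∀ n → 1 + (n + 1) + (n + suc (1 + n * (2 * n + 2) + (n * n + 1))) ≡ 3 * (n * n) + (4 * n + 5)
    expand = solve-∀

    collect : ∀ x → 3 * x + (4 * x + 5 * x) ≡ 12 * x
    collect = solve-∀

  -- The setup takes at most 12ℓ steps, and there are at most 2ℓ rounds of at most 9ℓ² + 5ℓ steps.
  -- This gives 18ℓ³ + 10ℓ² + 12ℓ, and 18 + 10 + 12 = 40.
  totalCost≤ : setupCost m + suc (n * (n * 1)) * roundCost m ≤ 40 * ℓ ^ 3 + 40
  totalCost≤ = begin
    setupCost m + suc (n * (n * 1)) * roundCost m
      ≤⟨ +-mono-≤ setupCost≤ (*-mono-≤ rounds≤ roundCost≤) ⟩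
    12 * ℓ + (ℓ + ℓ) * (ℓ * (9 * ℓ) + 5 * ℓ)
      ≤⟨ m≤m+n _ _ ⟩
    -- The added term is the exact slack, expanded in `l` instead of `ℓ` because its coefficients
    -- are then natural numbers.
    12 * ℓ + (ℓ + ℓ) * (ℓ * (9 * ℓ) + 5 * ℓ) + (22 * (l * (l * l)) + 56 * (l * l) + 34 * l + 40)
      ≡⟨ collect l ⟩
    40 * ℓ ^ 3 + 40 ∎
    where
    rounds≤ : suc (n * (n * 1)) ≤ ℓ + ℓ
    rounds≤ = +-mono-≤ 1≤ℓ (≤-trans (≤-reflexive (cong (n *_) (*-identityʳ n))) n²≤ℓ)

    collect : ∀ l → 12 * suc l + (suc l + suc l) * (suc l * (9 * suc l) + 5 * suc l) + (22 * (l * (l * l)) + 56 * (l * l) + 34 * l + 40)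
                  ≡ 40 * (suc l * (suc l * (suc l * 1))) + 40
    collect = solve-∀

-- The encoded graph on the tape and the decision on its matrix.

adjacencyRows : ∀ {n} → Graph n → Vec (Vec Cell n) n
adjacencyRows G = tabulate λ u → tabulate λ v → bit (Graph.adj G u v)

cells : List Bool → List Γ
cells = List.map (λ x → just (bit x))

-- `g` generalises the identity in `allFin`; the recursion continues with `g ∘ suc`.
cells-row : ∀ {n k} (f : Fin n → Bool) (g : Fin k → Fin n) l →
            cells (List.map f (List.tabulate g)) List.++ l ≡ tabulate (λ v → bit (f (g v))) ▹ l
cells-row {k = zero}  f g l = refl
cells-row {k = suc k} f g l = cong (_ ∷_) (cells-row f (g ∘ suc) l)

cells-rows : ∀ {n k} (f : Fin n → Fin n → Bool) (g : Fin k → Fin n) →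
             cells (List.concatMap (λ u → List.map (f u) (List.allFin n)) (List.tabulate g)) ≡
             tabulate (λ u → tabulate (λ v → bit (f (g u) v))) ▸ []
cells-rows {k = zero}  f g = refl
cells-rows {n} {suc k} f g =
  trans (List.map-++ _ (List.map (f (g zero)) (List.allFin n)) _)
    (trans (cells-row (f (g zero)) id _) (cong (tabulate (λ v → bit (f (g zero) v)) ▹_) (cells-rows f (g ∘ suc))))

cells-unary : ∀ n l → cells (List.replicate n true List.++ l) ≡ Vec.map bit (replicate n true) ▹ cells l
cells-unary zero    l = refl
cells-unary (suc n) l = cong (_ ∷_) (cells-unary n l)

cells-encodeGraph : ∀ {n} (G : Graph n) →
  cells (encodeGraph (n , G)) ≡ Vec.map bit (replicate n true) ▹ just (bit false) ∷ adjacencyRows G ▸ []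
cells-encodeGraph {n} G =
  trans (cells-unary n _) (cong (λ l → Vec.map bit (replicate n true) ▹ just (bit false) ∷ l) (cells-rows (Graph.adj G) id))

length-rows : ∀ {n k} (f : Fin n → Fin n → Bool) (g : Fin k → Fin n) →
              List.length (List.concatMap (λ u → List.map (f u) (List.allFin n)) (List.tabulate g)) ≡ k * n
length-rows {k = zero}  f g = refl
length-rows {n} {suc k} f g =
  trans (List.length-++ (List.map (f (g zero)) (List.allFin n)))
    (cong₂ _+_ (trans (List.length-map _ (List.allFin n)) (List.length-tabulate id)) (length-rows f (g ∘ suc)))

length-encodeGraph : ∀ {n} (G : Graph n) → List.length (encodeGraph (n , G)) ≡ n + suc (n * n)
length-encodeGraph {n} G =
  trans (List.length-++ (List.replicate n true))
    (cong₂ (λ i j → i + suc j) (List.length-replicate n) (length-rows (Graph.adj G) id))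

module _ (bad : Cell → Cell → Cell → Bool) where
  open Decider bad

  decider : TuringMachine
  decider = machine code (start , false , false , false)

  onInput : List Γ → Config
  onInput input = ⟨ (start , false , false , false) , [] ▮ input , [] ▮ [] , [] ▮ [] , [] ▮ [] ⟩

  initial-onInput : ∀ w → initial decider w ≡ toConfiguration code (start , false , false , false) (onInput (cells w))
  initial-onInput w = cong (λ z → TuringMachine.start decider , z ∷ _) (input w)
    where
    input : ∀ w → fromList (List.map bit w) ≡ toTape ([] ▮ cells w)
    input []      = refl
    input (x ∷ w) = cong (tape [] (bit x)) (List.map-∘ w)

  runFor-haltsWith : ∀ {a j k} w → HaltsWith a j (onInput (cells w)) → j ≤ k → runFor decider k (initial decider w) ≡ just a
  runFor-haltsWith {a} {j} {k} w (halts h) j≤k =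
    trans (cong (runFor decider k) (initial-onInput w))
      (trans (runFor-run code (start , false , false , false) k (onInput (cells w)))
        (trans (cong (λ t → run t (onInput (cells w))) (sym (m+[n∸m]≡n j≤k))) (h (k ∸ j))))

adjacencyCells : ∀ {n} → Graph n → Fin n → Fin n → Cell
adjacencyCells G u v = if does (u Fin.≟ v) then dia else bit (Graph.adj G u v)

module _ (bad : Cell → Cell → Cell → Bool) (horn : Horn bad) where
  open Decider bad
  open Correctness bad horn

  cellAt-adjacencyRows : ∀ {n} (G : Graph n) u v →
    cellAt (markRows (replicate n true) (adjacencyRows G)) u v ≡ adjacencyCells G u v
  cellAt-adjacencyRows {n} G u v = trans (cellAt-markRows (adjacencyRows G) u v)
    (cong (if does (u Fin.≟ v) then dia else_)
      (trans (cong (λ r → lookup r v) (lookup∘tabulate (λ u → tabulate (λ v → bit (Graph.adj G u v))) u))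
             (lookup∘tabulate (λ v → bit (Graph.adj G u v)) v)))

  adjacencyCells-sym : ∀ {n} (G : Graph n) u v → adjacencyCells G u v ≡ adjacencyCells G v u
  adjacencyCells-sym G u v with u Fin.≟ v | v Fin.≟ u
  ... | yes _    | yes _    = refl
  ... | yes refl | no  v≢u  = contradiction refl v≢u
  ... | no  u≢v  | yes refl = contradiction refl u≢v
  ... | no  _    | no  _    = cong bit (Graph.symm G u v)

  erase-adjacencyCells : ∀ {n} (G : Graph n) u v → erase (adjacencyCells G u v) ≡ adjacencyCells G u v
  erase-adjacencyCells G u v with does (u Fin.≟ v)
  ... | true  = refl
  ... | false = refl

  below-adjacency : ∀ {n} (G : Graph n) → Below (adjacencyCells G) (markRows (replicate n true) (adjacencyRows G))
  below-adjacency G = record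
    { symmetric  = λ u v → trans (cellAt-adjacencyRows G u v)
        (trans (adjacencyCells-sym G u v) (sym (cellAt-adjacencyRows G v u)))
    ; underlying = λ u v → trans (cong erase (cellAt-adjacencyRows G u v)) (erase-adjacencyCells G u v)
    ; hotOnly    = λ _ u v eq → contradiction (trans (sym (cellAt-adjacencyRows G u v)) eq) (notHot u v)
    }
    where
    notHot : ∀ u v → adjacencyCells G u v ≢ hot
    notHot u v eq with does (u Fin.≟ v)
    notHot u v () | true
    notHot u v () | false

module _ (bad : Cell → Cell → Cell → Bool) (horn : Horn bad) where
  open Decider bad
  open Correctness bad horn
  adjacencyDecided : ∀ {n} (G : Graph n) → ∃ λ a →
    runFor (decider bad) (40 * List.length (encodeGraph (n , G)) ^ 3 + 40) (initial (decider bad) (encodeGraph (n , G))) ≡ just a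
    × Reflects (∃ (Solution bad (adjacencyCells G))) a
  -- The machine accepts at the separator in one step, and the empty matrix is a solution.
  adjacencyDecided {zero} G =
    true ,
    runFor-haltsWith bad (encodeGraph (zero , G)) (haltsNow {j = 0} refl) (≤-trans (s≤s z≤n) (m≤n+m 40 (40 * 1 ^ 3))) ,
    ofʸ ((λ ()) , record { symmetric = λ () ; underlying = λ () ; free = λ () })
  adjacencyDecided {suc m} G =
    let pl , cs , starts       = setup m (adjacencyRows G)
        a , halting , reflects = rounds (adjacencyCells G) cs (suc m * (suc m * 1)) rows
                                   (below-adjacency bad horn G) (coldCells≤ rows)
        haltsAtAll = subst (HaltsWith a (setupCost m + suc (suc m * (suc m * 1)) * roundCost m) ∘ onInput bad)
                       (sym (cells-encodeGraph G)) (haltsAfter starts halting)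
    in a , runFor-haltsWith bad (encodeGraph (suc m , G)) haltsAtAll bound , reflects
    where
    rows = markRows (replicate (suc m) true) (adjacencyRows G)

    bound : setupCost m + suc (suc m * (suc m * 1)) * roundCost m ≤ 40 * List.length (encodeGraph (suc m , G)) ^ 3 + 40
    bound = subst (λ ℓ → setupCost m + suc (suc m * (suc m * 1)) * roundCost m ≤ 40 * ℓ ^ 3 + 40) (sym (length-encodeGraph G))
      (TimeBound.totalCost≤ m (m + suc (suc m * suc m)) (m≤m+n (suc m) _)
        (≤-trans (m≤n+m (suc m * suc m) (suc (suc m))) (≤-reflexive (sym (+-suc (suc m) (suc m * suc m))))))

-- Containment as a link-preserving injection.

linkOf : (b : Bool) → (T b → Colour) → Maybe Colour
linkOf false c = nothing
linkOf true  c = just (c tt)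

linkOf-cong : ∀ {b b′ c c′} → b ≡ b′ → (∀ e e′ → c e ≡ c′ e′) → linkOf b c ≡ linkOf b′ c′
linkOf-cong {false} refl _  = refl
linkOf-cong {true}  refl eq = cong just (eq tt tt)

linkOf-injective : ∀ {b b′ c c′} → linkOf b c ≡ linkOf b′ c′ → b ≡ b′ × ∀ e e′ → c e ≡ c′ e′
linkOf-injective {false} {false} _    = refl , λ ()
linkOf-injective {true}  {true}  eq   = refl , λ _ _ → just-injective eq

linkOf-just : ∀ x → linkOf (is-just x) (to-witness-T x) ≡ x
linkOf-just (just _) = refl
linkOf-just nothing  = refl

-- Merging adjacency with the colour, which depends on a proof of adjacency, turns the two
-- conditions on an isomorphism into one equation.
link : ∀ {n} → ColouredGraph n → Fin n → Fin n → Maybe Colour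
link G u v = linkOf (ColouredGraph.adj G u v) (ColouredGraph.colour G u v)

link-sym : ∀ {n} (G : ColouredGraph n) u v → link G u v ≡ link G v u
link-sym (G , c) u v = linkOf-cong (Graph.symm G u v) (EdgeColouring.symm c u v)

link-irrefl : ∀ {n} (G : ColouredGraph n) u → link G u u ≡ nothing
link-irrefl (G , c) u with Graph.adj G u u | Graph.irrefl G u | EdgeColouring.colour c u u
... | false | _ | _ = refl

≅-link : ∀ {m n} {G : ColouredGraph m} {H : ColouredGraph n} (i : G ≅ H) u v → link G u v ≡ link H (_≅_.σ i u) (_≅_.σ i v)
≅-link i u v = linkOf-cong (_≅_.adj-preserved i u v) (_≅_.colour-preserved i u v)

-- Containment with the isomorphism absorbed into the injection: the images of the pattern's
-- vertices can be read off directly.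
record Embeds {m n} (G : ColouredGraph n) (H : ColouredGraph m) : Set where
  field
    f         : Fin m → Fin n
    injective : ∀ {i j} → f i ≡ f j → i ≡ j
    link-≡    : ∀ i j → link G (f i) (f j) ≡ link H i j

module _ {m n : ℕ} {G : ColouredGraph n} where

  contains⇒embeds : ∀ {H : ColouredGraph m} → G Contains H → Embeds G H
  contains⇒embeds {H} (ι , i) = record
    { f         = λ x → Injection.to ι (_≅_.bijection i ⟨$⟩ˡ x)
    ; injective = λ eq → Injection.injective (↔⇒↣ (↔-sym (_≅_.bijection i))) (Injection.injective ι eq)
    ; link-≡    = λ x y → trans (≅-link i _ _)
        (cong₂ (link H) (inverseʳ (_≅_.bijection i)) (inverseʳ (_≅_.bijection i)))
    }

  embeds⇒contains : ∀ {H : ColouredGraph m} → Embeds G H → G Contains H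
  embeds⇒contains e = mk↣ (Embeds.injective e) , record
    { bijection        = Permutation.id
    ; adj-preserved    = λ u v → proj₁ (linkOf-injective (Embeds.link-≡ e u v))
    ; colour-preserved = λ u v → proj₂ (linkOf-injective (Embeds.link-≡ e u v))
    }

  embeds-≅ : ∀ {H K : ColouredGraph m} → H ≅ K → Embeds G H → Embeds G K
  embeds-≅ {K = K} i e = record
    { f         = λ x → Embeds.f e (_≅_.bijection i ⟨$⟩ˡ x)
    ; injective = λ eq → Injection.injective (↔⇒↣ (↔-sym (_≅_.bijection i))) (Embeds.injective e eq)
    ; link-≡    = λ x y → trans (Embeds.link-≡ e _ _)
        (trans (≅-link i _ _) (cong₂ (link K) (inverseʳ (_≅_.bijection i)) (inverseʳ (_≅_.bijection i))))
    }

  embeds-≅⁻ : ∀ {H K : ColouredGraph m} → H ≅ K → Embeds G K → Embeds G H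
  embeds-≅⁻ i e = record
    { f         = λ x → Embeds.f e (_≅_.σ i x)
    ; injective = λ eq → Injection.injective (↔⇒↣ (_≅_.bijection i)) (Embeds.injective e eq)
    ; link-≡    = λ x y → trans (Embeds.link-≡ e _ _) (sym (≅-link i x y))
    }

-- Patterns as Horn predicates on cells.

-- The links 01, 12, 02 of a pattern on three vertices.
Pattern : Set
Pattern = Maybe Colour × Maybe Colour × Maybe Colour

graphOf : Pattern → ColouredGraph 3
graphOf (e₀₁ , e₁₂ , e₀₂) = onThreeVertices e₀₁ e₁₂ e₀₂

infix 7 _==_

_==_ : Cell → Cell → Bool
bit true  == bit true  = true
bit false == bit false = true
dia       == dia       = true
hot       == hot       = true
_         == _         = false

==-refl : ∀ x → (x == x) ≡ true
==-refl (bit true)  = refl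
==-refl (bit false) = refl
==-refl dia         = refl
==-refl hot         = refl

==-sound : ∀ x y → (x == y) ≡ true → x ≡ y
==-sound (bit true)  (bit true)  _ = refl
==-sound (bit false) (bit false) _ = refl
==-sound dia         dia         _ = refl
==-sound hot         hot         _ = refl

-- The six orders of three vertices induce all six orders of their pairs, so this finds a pattern
-- however its vertices are arranged. The bracketing lets each transposition permute whole blocks.
onSomeOrder : (Cell → Cell → Cell → Bool) → Cell → Cell → Cell → Bool
onSomeOrder f x y z = (f x y z ∨ f x z y) ∨ ((f y x z ∨ f y z x) ∨ (f z x y ∨ f z y x))

∨-left-comm : ∀ p q r → p ∨ (q ∨ r) ≡ q ∨ (p ∨ r)
∨-left-comm p q r = trans (sym (∨-assoc p q r)) (trans (cong (_∨ r) (∨-comm p q)) (∨-assoc q p r))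

onSomeOrder-swap₁₂ : ∀ f x y z → onSomeOrder f x y z ≡ onSomeOrder f y x z
onSomeOrder-swap₁₂ f x y z = trans (∨-left-comm (f x y z ∨ f x z y) (f y x z ∨ f y z x) (f z x y ∨ f z y x))
  (cong (λ r → (f y x z ∨ f y z x) ∨ ((f x y z ∨ f x z y) ∨ r)) (∨-comm (f z x y) (f z y x)))

onSomeOrder-swap₂₃ : ∀ f x y z → onSomeOrder f x y z ≡ onSomeOrder f x z y
onSomeOrder-swap₂₃ f x y z = cong₂ _∨_ (∨-comm (f x y z) (f x z y)) (∨-comm (f y x z ∨ f y z x) (f z x y ∨ f z y x))

∨-true : ∀ p {q} → p ∨ q ≡ true → p ≡ true ⊎ q ≡ true
∨-true true  _  = inj₁ refl
∨-true false eq = inj₂ eq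

∨-introˡ : ∀ {p} q → p ≡ true → p ∨ q ≡ true
∨-introˡ _ refl = refl

∨-false : ∀ p {q} → p ∨ q ≡ false → p ≡ false × q ≡ false
∨-false false eq = refl , eq

paint : Colour → Maybe Colour → Cell
paint κ    nothing     = bit false
paint red  (just red)  = hot
paint red  (just blue) = bit true
paint blue (just red)  = bit true
paint blue (just blue) = hot

paint≢dia : ∀ κ e → paint κ e ≢ dia
paint≢dia red  nothing     ()
paint≢dia blue nothing     ()
paint≢dia red  (just red)  ()
paint≢dia red  (just blue) ()
paint≢dia blue (just red)  ()
paint≢dia blue (just blue) ()

colourOf : Colour → Cell → Colour
colourOf κ    hot = κ
colourOf red  _   = blue
colourOf blue _   = red

unpaint : Colour → Cell → Maybe Colour
unpaint κ (bit false) = nothing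
unpaint κ x           = just (colourOf κ x)

unpaint-paint : ∀ κ e → unpaint κ (paint κ e) ≡ e
unpaint-paint κ    nothing     = refl
unpaint-paint red  (just red)  = refl
unpaint-paint red  (just blue) = refl
unpaint-paint blue (just red)  = refl
unpaint-paint blue (just blue) = refl

paint-linkOf-colourOf : ∀ κ b x → erase x ≡ bit b → paint κ (linkOf b (λ _ → colourOf κ x)) ≡ x
paint-linkOf-colourOf κ    false (bit false) refl = refl
paint-linkOf-colourOf red  true  (bit true)  refl = refl
paint-linkOf-colourOf blue true  (bit true)  refl = refl
paint-linkOf-colourOf red  true  hot         refl = refl
paint-linkOf-colourOf blue true  hot         refl = refl

erase-paint-linkOf : ∀ κ b c → erase (paint κ (linkOf b c)) ≡ bit b
erase-paint-linkOf κ false c = refl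
erase-paint-linkOf κ true  c with c tt
erase-paint-linkOf red  true c | red  = refl
erase-paint-linkOf red  true c | blue = refl
erase-paint-linkOf blue true c | red  = refl
erase-paint-linkOf blue true c | blue = refl

module _ (κ : Colour) where

  -- A pattern lists its links as 01, 12, 02, whereas the cells come as 01, 02, 12.
  matches : Pattern → Cell → Cell → Cell → Bool
  matches (e₀₁ , e₁₂ , e₀₂) x y z = paint κ e₀₁ == x ∧ (paint κ e₀₂ == y ∧ paint κ e₁₂ == z)

  forbidden : List Pattern → Cell → Cell → Cell → Bool
  forbidden ps x y z = any (λ p → onSomeOrder (matches p) x y z) ps

  -- By the symmetry of `onSomeOrder` it suffices to put the two cold cells first. In this form a
  -- concrete pattern is checked by evaluation.
  AtMostOneCold : Pattern → Set
  AtMostOneCold p = ∀ x → onSomeOrder (matches p) (bit true) (bit true) x ≡ false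

  forbidden-cold : ∀ {ps} → All AtMostOneCold ps → ∀ x → forbidden ps (bit true) (bit true) x ≡ false
  forbidden-cold []       x = refl
  forbidden-cold (p ∷ ps) x rewrite p x = forbidden-cold ps x

  forbidden-horn : ∀ {ps} → All AtMostOneCold ps → Horn (forbidden ps)
  forbidden-horn {ps} few = record
    { swap₁₂ = swap₁₂
    ; swap₂₃ = swap₂₃
    ; cold   = λ y z eq → notCold y z eq , notCold z y (trans (swap₂₃ (bit true) z y) eq)
    }
    where
    swap₁₂ : ∀ x y z → forbidden ps x y z ≡ forbidden ps y x z
    swap₁₂ x y z = cong or (List.map-cong (λ p → onSomeOrder-swap₁₂ (matches p) x y z) ps)

    swap₂₃ : ∀ x y z → forbidden ps x y z ≡ forbidden ps x z y
    swap₂₃ x y z = cong or (List.map-cong (λ p → onSomeOrder-swap₂₃ (matches p) x y z) ps)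

    notCold : ∀ y z → forbidden ps (bit true) y z ≡ true → y ≢ bit true
    notCold _ z eq refl with () ← trans (sym eq) (forbidden-cold few z)

  -- Free colourings and solutions.

  module _ {n : ℕ} (G : ColouredGraph n) where

    cellOf : Fin n → Fin n → Cell
    cellOf u v = if does (u Fin.≟ v) then dia else paint κ (link G u v)

    cellOf-≢ : ∀ {u v} → u ≢ v → cellOf u v ≡ paint κ (link G u v)
    cellOf-≢ {u} {v} u≢v with u Fin.≟ v
    ... | yes u≡v = contradiction u≡v u≢v
    ... | no  _   = refl

    cellOf-sym : ∀ u v → cellOf u v ≡ cellOf v u
    cellOf-sym u v with u Fin.≟ v | v Fin.≟ u
    ... | yes _    | yes _    = refl
    ... | yes refl | no  v≢u  = contradiction refl v≢u
    ... | no  u≢v  | yes refl = contradiction refl u≢v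
    ... | no  _    | no  _    = cong (paint κ) (link-sym G u v)

    -- No painted link is `dia`, so a match forces distinct vertices. This is where the injectivity
    -- of the embedding comes from.
    cellOf-paint : ∀ e u v → paint κ e ≡ cellOf u v → u ≢ v × link G u v ≡ e
    cellOf-paint e u v eq with u Fin.≟ v
    ... | yes _  = contradiction eq (paint≢dia κ e)
    ... | no u≢v = u≢v , trans (sym (unpaint-paint κ _)) (trans (cong (unpaint κ) (sym eq)) (unpaint-paint κ e))

    embeds⇒matches : ∀ p → Embeds G (graphOf p) →
      ∃ λ u → ∃ λ v → ∃ λ w → onSomeOrder (matches p) (cellOf u v) (cellOf u w) (cellOf v w) ≡ true
    embeds⇒matches p@(e₀₁ , e₁₂ , e₀₂) e =
      f 0F , f 1F , f 2F , ∨-introˡ _ (∨-introˡ _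
        (cong₂ _∧_ (same e₀₁ 0F 1F (λ ()) (linkOf-just e₀₁))
          (cong₂ _∧_ (same e₀₂ 0F 2F (λ ()) (linkOf-just e₀₂)) (same e₁₂ 1F 2F (λ ()) (linkOf-just e₁₂)))))
      where
      open Embeds e

      same : ∀ x i j → i ≢ j → link (graphOf p) i j ≡ x → (paint κ x == cellOf (f i) (f j)) ≡ true
      same x i j i≢j eq =
        trans (cong (paint κ x ==_) (trans (cellOf-≢ (i≢j ∘ injective)) (cong (paint κ) (trans (link-≡ i j) eq))))
              (==-refl (paint κ x))

    matches⇒embeds : ∀ p u v w → matches p (cellOf u v) (cellOf u w) (cellOf v w) ≡ true → Embeds G (graphOf p)
    matches⇒embeds p@(e₀₁ , e₁₂ , e₀₂) u v w eq
      with eq₀₁ , eq′ ← ∧-true (paint κ e₀₁ == cellOf u v) eq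
      with eq₀₂ , eq₁₂ ← ∧-true (paint κ e₀₂ == cellOf u w) eq′
      with u≢v , uv ← cellOf-paint e₀₁ u v (==-sound _ _ eq₀₁)
         | u≢w , uw ← cellOf-paint e₀₂ u w (==-sound _ _ eq₀₂)
         | v≢w , vw ← cellOf-paint e₁₂ v w (==-sound _ _ eq₁₂) = record
      { f = f ; injective = λ {i} {j} → injective i j ; link-≡ = link-≡ }
      where
      f : Fin 3 → Fin n
      f 0F = u
      f 1F = v
      f 2F = w

      injective : ∀ i j → f i ≡ f j → i ≡ j
      injective 0F 0F _  = refl
      injective 0F 1F eq = contradiction eq u≢v
      injective 0F 2F eq = contradiction eq u≢w
      injective 1F 0F eq = contradiction (sym eq) u≢v
      injective 1F 1F _  = refl
      injective 1F 2F eq = contradiction eq v≢w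
      injective 2F 0F eq = contradiction (sym eq) u≢w
      injective 2F 1F eq = contradiction (sym eq) v≢w
      injective 2F 2F _  = refl

      link-≡ : ∀ i j → link G (f i) (f j) ≡ link (graphOf p) i j
      link-≡ 0F 0F = link-irrefl G u
      link-≡ 0F 1F = trans uv (sym (linkOf-just e₀₁))
      link-≡ 0F 2F = trans uw (sym (linkOf-just e₀₂))
      link-≡ 1F 0F = trans (link-sym G v u) (trans uv (sym (linkOf-just e₀₁)))
      link-≡ 1F 1F = link-irrefl G v
      link-≡ 1F 2F = trans vw (sym (linkOf-just e₁₂))
      link-≡ 2F 0F = trans (link-sym G w u) (trans uw (sym (linkOf-just e₀₂)))
      link-≡ 2F 1F = trans (link-sym G w v) (trans vw (sym (linkOf-just e₁₂)))
      link-≡ 2F 2F = link-irrefl G w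

    -- Each order of the cells belongs to one order of the vertices, after which the case is named:
    -- `uv`, `vw`, `uw` are the cells of `v`, `u`, `w`.
    onSomeOrder⇒embeds : ∀ p u v w → onSomeOrder (matches p) (cellOf u v) (cellOf u w) (cellOf v w) ≡ true →
                         Embeds G (graphOf p)
    onSomeOrder⇒embeds p u v w eq with ∨-true (matches p _ _ _ ∨ matches p _ _ _) eq
    ... | inj₁ eq₁ with ∨-true (matches p _ _ _) eq₁
    ...   | inj₁ uvw = matches⇒embeds p u v w uvw
    ...   | inj₂ vuw rewrite cellOf-sym u v = matches⇒embeds p v u w vuw
    onSomeOrder⇒embeds p u v w eq | inj₂ eq₂ with ∨-true (matches p _ _ _ ∨ matches p _ _ _) eq₂
    ... | inj₁ eq₁ with ∨-true (matches p _ _ _) eq₁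
    ...   | inj₁ uwv rewrite cellOf-sym v w = matches⇒embeds p u w v uwv
    ...   | inj₂ wuv rewrite cellOf-sym u w | cellOf-sym v w = matches⇒embeds p w u v wuv
    onSomeOrder⇒embeds p u v w eq | inj₂ eq₂ | inj₂ eq₃ with ∨-true (matches p _ _ _) eq₃
    ...   | inj₁ vwu rewrite cellOf-sym u v | cellOf-sym u w = matches⇒embeds p v w u vwu
    ...   | inj₂ wvu rewrite cellOf-sym v w | cellOf-sym u w | cellOf-sym u v = matches⇒embeds p w v u wvu

    free⇒unforbidden : ∀ {F ps} → Pointwise (λ H p → H ≅ graphOf p) F ps → F -Free G →
                       ∀ u v w → forbidden ps (cellOf u v) (cellOf u w) (cellOf v w) ≡ false
    free⇒unforbidden []       []       u v w = refl
    free⇒unforbidden {ps = p ∷ ps} (i ∷ is) (¬c ∷ free) u v w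
      with onSomeOrder (matches p) (cellOf u v) (cellOf u w) (cellOf v w) in eq
    ... | true  = contradiction (embeds⇒contains (embeds-≅⁻ i (onSomeOrder⇒embeds p u v w eq))) ¬c
    ... | false = free⇒unforbidden is free u v w

    unforbidden⇒free : ∀ {F ps} → Pointwise (λ H p → H ≅ graphOf p) F ps →
                       (∀ u v w → forbidden ps (cellOf u v) (cellOf u w) (cellOf v w) ≡ false) → F -Free G
    unforbidden⇒free []       _ = []
    unforbidden⇒free {ps = p ∷ ps} (i ∷ is) unforbidden =
      (λ c → case (embeds⇒matches p (embeds-≅ i (contains⇒embeds c)))) ∷
      unforbidden⇒free is (λ u v w → proj₂ (∨-false (onSomeOrder (matches p) _ _ _) (unforbidden u v w)))
      where
      case : ¬ ∃ λ u → ∃ λ v → ∃ λ w → onSomeOrder (matches p) (cellOf u v) (cellOf u w) (cellOf v w) ≡ true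
      case (u , v , w , eq)
        with () ← trans (sym eq) (proj₁ (∨-false (onSomeOrder (matches p) _ _ _) (unforbidden u v w)))

  module _ {n : ℕ} (G : Graph n) {F : List (ColouredGraph 3)} {ps : List Pattern}
           (patterns : Pointwise (λ H p → H ≅ graphOf p) F ps) where

    colouring⇒solution : AdmitsFreeColouring F (n , G) → ∃ (Solution (forbidden ps) (adjacencyCells G))
    colouring⇒solution (c , free) = cellOf (G , c) , record
      { symmetric  = cellOf-sym (G , c)
      ; underlying = underlying
      ; free       = free⇒unforbidden (G , c) patterns free
      }
      where
      underlying : ∀ u v → erase (cellOf (G , c) u v) ≡ adjacencyCells G u v
      underlying u v with does (u Fin.≟ v)
      ... | true  = refl
      ... | false = erase-paint-linkOf κ (Graph.adj G u v) (EdgeColouring.colour c u v)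

    solution⇒colouring : ∃ (Solution (forbidden ps) (adjacencyCells G)) → AdmitsFreeColouring F (n , G)
    solution⇒colouring (N , sol) = c , unforbidden⇒free (G , c) patterns unforbidden
      where
      open Solution sol

      c : EdgeColouring G
      c = record
        { colour = λ u v _ → colourOf κ (N u v)
        ; symm   = λ u v _ _ → cong (colourOf κ) (symmetric u v)
        }

      cellOf-≡ : ∀ u v → cellOf (G , c) u v ≡ N u v
      cellOf-≡ u v with does (u Fin.≟ v) | underlying u v
      ... | true  | eq = sym (erase-injective (N u v) dia (λ ()) (λ ()) eq)
      ... | false | eq = paint-linkOf-colourOf κ (Graph.adj G u v) (N u v) eq

      unforbidden : ∀ u v w → forbidden ps (cellOf (G , c) u v) (cellOf (G , c) u w) (cellOf (G , c) v w) ≡ false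
      unforbidden u v w rewrite cellOf-≡ u v | cellOf-≡ u w | cellOf-≡ v w = free u v w

  -- The members of `F` are only isomorphic to listed graphs. The machine is built from the listed
  -- patterns, chosen here before any input graph is given.
  selectPatterns : ∀ {F} ts → All AtMostOneCold ts → F ⊆≅ List.map graphOf ts →
                   ∃ λ ps → Pointwise (λ H p → H ≅ graphOf p) F ps × All AtMostOneCold ps
  selectPatterns ts few []        = [] , [] , []
  selectPatterns ts few (i ∷ F⊆) with select few i | selectPatterns ts few F⊆
    where
    select : ∀ {H ts} → All AtMostOneCold ts → Any (H ≅_) (List.map graphOf ts) → ∃ λ p → H ≅ graphOf p × AtMostOneCold p
    select (few ∷ _)  (here i)  = _ , i , few
    select (_ ∷ fews) (there i) = select fews i
  ... | p , isom , few′ | ps , isoms , fews = p ∷ ps , isom ∷ isoms , few′ ∷ fews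

  solvable : ∀ {F} ts → All AtMostOneCold ts → F ⊆≅ List.map graphOf ts →
             SolvableInPolynomialTime encodeGraph (AdmitsFreeColouring F)
  solvable ts few F⊆ with ps , patterns , fews ← selectPatterns ts few F⊆ =
    decider (forbidden ps) , 40 , 3 , λ (n , G) →
      let a , runs , reflects = adjacencyDecided (forbidden ps) (forbidden-horn fews) G
      in a , runs , transfer (solution⇒colouring G patterns) (colouring⇒solution G patterns) reflects
    where
    transfer : ∀ {A B : Set} {a} → (A → B) → (B → A) → Reflects A a → Reflects B a
    transfer f g (ofʸ x)  = ofʸ (f x)
    transfer f g (ofⁿ ¬x) = ofⁿ (¬x ∘ g)

-- The two families of patterns.

onEachCell : {P : Cell → Set} → P (bit false) → P (bit true) → P dia → P hot → ∀ x → P x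
onEachCell p q r s (bit false) = p
onEachCell p q r s (bit true)  = q
onEachCell p q r s dia         = r
onEachCell p q r s hot         = s

lemma38 : (F : List (ColouredGraph 3)) →
    (F ⊆≅ (3K₁ ∷ ʳco-P₃ ∷ ᵇco-P₃ ∷ ʳP₃ ∷ ʳᵇP₃ ∷ ʳK₃ ∷ ʳʳᵇK₃ ∷ [])) ⊎ (F ⊆≅ (3K₁ ∷ ʳco-P₃ ∷ ᵇco-P₃ ∷ ᵇP₃ ∷ ʳᵇP₃ ∷ ᵇK₃ ∷ ʳᵇᵇK₃ ∷ [])) →
    SolvableInPolynomialTime encodeGraph (AdmitsFreeColouring F)
lemma38 F (inj₁ F⊆) = solvable red
  ( (nothing , nothing , nothing) ∷ (just red , nothing , nothing) ∷ (just blue , nothing , nothing) ∷ (just red , just red , nothing)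
  ∷ (just red , just blue , nothing) ∷ (just red , just red , just red) ∷ (just red , just red , just blue) ∷ [])
  -- Blue is cold here. Each pattern is evaluated on two cold cells and every possible third cell.
  ( onEachCell refl refl refl refl ∷ onEachCell refl refl refl refl
  ∷ onEachCell refl refl refl refl ∷ onEachCell refl refl refl refl
  ∷ onEachCell refl refl refl refl ∷ onEachCell refl refl refl refl
  ∷ onEachCell refl refl refl refl ∷ []) F⊆
lemma38 F (inj₂ F⊆) = solvable blue
  ( (nothing , nothing , nothing) ∷ (just red , nothing , nothing) ∷ (just blue , nothing , nothing) ∷ (just blue , just blue , nothing)
  ∷ (just red , just blue , nothing) ∷ (just blue , just blue , just blue) ∷ (just red , just blue , just blue) ∷ [])
  ( onEachCell refl refl refl refl ∷ onEachCell refl refl refl refl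
  ∷ onEachCell refl refl refl refl ∷ onEachCell refl refl refl refl
  ∷ onEachCell refl refl refl refl ∷ onEachCell refl refl refl refl
  ∷ onEachCell refl refl refl refl ∷ []) F⊆
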